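{- Let $q\geq 1$ and $0\leq r<s$ be fixed integers, let $x$ be a variable (or a complex number), and for $k\ge 0$ set $$b_k := B_k\!\left(\tfrac{x+r}{q}\right)-B_k\!\left(\tfrac{x+s}{q}\right).$$ Then for all integers $m\geq 0$ we have $H_{2m}(b_k)=0$ and $$H_{2m+1}(b_k)=(-1)^{m+1}\left(\frac{s-r}{q^{m+1}}\right)^{2m+2}\prod_{\ell=1}^m\left(\frac{\ell^4\big((s-r)^2-(q\ell)^2\big)}{4(2\ell+1)(2\ell-1)}\right)^{2(m+1-\ell)}.$$
   Context: The Bernoulli polynomials $B_k(x)$ are defined by $\frac{te^{xt}}{e^t-1}=\sum_{k\ge 0}B_k(x)\frac{t^k}{k!}$. For a sequence $(c_0,c_1,c_2,\ldots)$ (indexed from $k=0$), the $n$th Hankel determinant is $H_n(c_k)=\det\big(c_{i+j}\big)_{0\le i,j\le n}$, an $(n+1)\times(n+1)$ determinant. Empty products equal $1$. -}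

module Defs where

open import Level using (Level; _⊔_) renaming (suc to lsuc)
open import Algebra.Bundles using (CommutativeRing)
open import Algebra.Morphism.Structures using (IsRingHomomorphism)
import Algebra.Definitions.RawSemiring as RawSemiringDefs
import Algebra.Properties.Ring as RingProperties
import Algebra.Properties.Semiring.Exp as SemiringExp
import Algebra.Properties.Semiring.Sum as SemiringSum
open import Data.Fin.Base using (Fin; zero; suc; toℕ; punchIn)
open import Data.Integer.Base as ℤ using (+_)
open import Data.Nat.Base as ℕ using (ℕ; zero; suc; NonZero; _!)
import Data.Nat.Properties as ℕₚ
open import Data.Rational.Base as ℚ using (ℚ; 1ℚ)
import Data.Rational.Properties as ℚₚ
import Data.Rational.Unnormalised.Base as ℚᵘ
import Data.Rational.Unnormalised.Properties as ℚᵘₚ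
open import Relation.Binary.PropositionalEquality as ≡ using (_≡_)

private
  variable
    c ℓ : Level

------------------------------------------------------------------------
-- Rational numbers

open RawSemiringDefs ℚ.+-*-rawSemiring public
  using () renaming (_^_ to _^ℚ_)

-- ∏₁ m f = f 1 · f 2 ⋯ f m
∏₁ : (m : ℕ) → ((k : ℕ) → .{{NonZero k}} → ℚ) → ℚ
∏₁ m f = RawSemiringDefs.product ℚ.+-*-rawSemiring
           (λ (i : Fin m) → f (suc (toℕ i)))

2k∸1≢0 : ∀ k → .{{NonZero k}} → NonZero (2 ℕ.* k ℕ.∸ 1)
2k∸1≢0 (suc k) = ≡.subst NonZero (≡.sym (ℕₚ.+-suc k (k ℕ.+ 0))) _

-- k⁴ ((s - r)² - (q k)²) / (4 (2k + 1) (2k - 1));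
-- the truncated subtraction is exact since k ≥ 1.
factor : (q r s k : ℕ) → .{{NonZero k}} → ℚ
factor q r s k =
  ((+ k) ℤ.^ 4 ℤ.* ((+ s ℤ.- + r) ℤ.^ 2 ℤ.- (+ q ℤ.* + k) ℤ.^ 2))
  ℚ./ (4 ℕ.* ((2 ℕ.* k ℕ.+ 1) ℕ.* (2 ℕ.* k ℕ.∸ 1)))
  where
  2k+1≢0 : NonZero (2 ℕ.* k ℕ.+ 1)
  2k+1≢0 = ≡.subst NonZero (ℕₚ.+-comm 1 (2 ℕ.* k)) _
  instance
    denominator≢0 : NonZero (4 ℕ.* ((2 ℕ.* k ℕ.+ 1) ℕ.* (2 ℕ.* k ℕ.∸ 1)))
    denominator≢0 = ℕₚ.m*n≢0 4 _
      {{_}} {{ℕₚ.m*n≢0 (2 ℕ.* k ℕ.+ 1) _ {{2k+1≢0}} {{2k∸1≢0 k}}}}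

1/_! : ℕ → ℚ
1/ n ! = (+ 1) ℚ./ (n !)
  where instance _ = n ℕₚ.!≢0

1/n*n≡1 : ∀ n .{{_ : NonZero n}} → ((+ 1) ℚ./ n) ℚ.* ((+ n) ℚ./ 1) ≡ 1ℚ
1/n*n≡1 n@(suc n-1) = ℚₚ.toℚᵘ-injective (begin
  ℚ.toℚᵘ (((+ 1) ℚ./ n) ℚ.* ((+ n) ℚ./ 1))
    ≈⟨ ℚₚ.toℚᵘ-homo-* ((+ 1) ℚ./ n) ((+ n) ℚ./ 1) ⟩
  ℚ.toℚᵘ ((+ 1) ℚ./ n) ℚᵘ.* ℚ.toℚᵘ ((+ n) ℚ./ 1)
    ≈⟨ ℚᵘₚ.*-cong (ℚₚ.toℚᵘ-fromℚᵘ (ℚᵘ.mkℚᵘ (+ 1) n-1))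
                  (ℚₚ.toℚᵘ-fromℚᵘ (ℚᵘ.mkℚᵘ (+ n) 0)) ⟩
  ℚᵘ.mkℚᵘ (+ 1) n-1 ℚᵘ.* ℚᵘ.mkℚᵘ (+ n) 0
    ≈⟨ ℚᵘₚ.*-inverseˡ (ℚᵘ.mkℚᵘ (+ n) 0) ⟩
  ℚᵘ.1ℚᵘ ∎)
  where open import Relation.Binary.Reasoning.Setoid ℚᵘₚ.≃-setoid

------------------------------------------------------------------------
-- Commutative ℚ-algebras.  They include both ℚ[x] (with x the variable)
-- and ℂ (with x any complex number).

record CommutativeℚAlgebra c ℓ : Set (lsuc (c ⊔ ℓ)) where
  field
    commutativeRing : CommutativeRing c ℓ

  open CommutativeRing commutativeRing public

  field
    ι                    : ℚ → Carrier
    ι-isRingHomomorphism : IsRingHomomorphism ℚ.+-*-rawRing rawRing ι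

module ℚAlgebraDefs (A : CommutativeℚAlgebra c ℓ) where

  open CommutativeℚAlgebra A hiding (zero)
  open SemiringSum semiring using (sum-syntax; sum-cong-≋)
  open SemiringExp semiring using (_^_)
  open RingProperties ring using (-0#≈0#)
  open import Relation.Binary.Reasoning.Setoid setoid
  private
    module ι = IsRingHomomorphism ι-isRingHomomorphism

  fromℕ : ℕ → Carrier
  fromℕ n = ι ((+ n) ℚ./ 1)

  infixl 7 _/ₙ_
  _/ₙ_ : Carrier → (n : ℕ) → .{{NonZero n}} → Carrier
  a /ₙ n = ι ((+ 1) ℚ./ n) * a

  ----------------------------------------------------------------------
  -- Determinants

  Matrix : ℕ → Set c
  Matrix n = Fin n → Fin n → Carrier

  -- Laplace expansion along the first row.
  det : ∀ {n} → Matrix n → Carrier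
  det {zero}  M = 1#
  det {suc n} M = ∑[ j < suc n ]
    ((- 1#) ^ toℕ j * M zero j * det (λ i k → M (suc i) (punchIn j k)))

  -- The matrix has size n + 1, not n.
  H : ℕ → (ℕ → Carrier) → Carrier
  H n a = det {suc n} (λ i j → a (toℕ i ℕ.+ toℕ j))

  ----------------------------------------------------------------------
  -- Formal power series in t: f n is the coefficient of tⁿ.

  Series : Set c
  Series = ℕ → Carrier

  infix  4 _≋_
  infixl 6 _⊖_
  infixl 7 _⊛_ _⊘_
  infixr 8 t·_

  _≋_ : Series → Series → Set ℓ
  f ≋ g = ∀ n → f n ≈ g n

  one : Series
  one zero    = 1#
  one (suc _) = 0#

  _⊖_ : Series → Series → Series
  (f ⊖ g) n = f n - g n

  _⊛_ : Series → Series → Series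
  (f ⊛ g) n = ∑[ i < suc n ] (f (toℕ i) * g (n ℕ.∸ toℕ i))

  t·_ : Series → Series
  (t· f) zero    = 0#
  (t· f) (suc n) = f n

  -- (f - f 0) / t
  tail : Series → Series
  tail f n = f (suc n)

  -- Long division.  It yields the quotient only when the divisor has
  -- constant term 1 (see ⊘-⊛).
  _⊘_ : Series → Series → Series
  (f ⊘ u) zero    = f zero
  (f ⊘ u) (suc n) = ((λ k → f (suc k) - f zero * u (suc k)) ⊘ u) n

  -- exp(y t)
  exp : Carrier → Series
  exp y n = ι (1/ n !) * y ^ n

  -- Σ aₖ tᵏ / k!
  egf : (ℕ → Carrier) → Series
  egf a k = ι (1/ k !) * a k

  ----------------------------------------------------------------------
  -- Bernoulli polynomials

  -- B k y / k! is the coefficient of tᵏ in t exp(y t) / (exp(t) - 1).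
  -- A factor t is cancelled from numerator and denominator so that the
  -- divisor has constant term 1; B-egf is the uncancelled identity.
  B : ℕ → Carrier → Carrier
  B k y = fromℕ (k !) * (exp y ⊘ tail (exp 1# ⊖ one)) k

  private
    a+[b-a]≈b : ∀ a b → a + (b - a) ≈ b
    a+[b-a]≈b a b = begin
      a + (b - a)   ≈⟨ +-congˡ (+-comm b (- a)) ⟩
      a + (- a + b) ≈⟨ +-assoc a (- a) b ⟨
      a - a + b     ≈⟨ +-congʳ (-‿inverseʳ a) ⟩
      0# + b        ≈⟨ +-identityˡ b ⟩
      b             ∎

    ⊛-tail : ∀ f g → g 0 ≈ 0# → f ⊛ g ≋ t· (f ⊛ tail g)
    ⊛-tail f g g₀≈0 zero = begin
      f 0 * g 0 + 0# ≈⟨ +-identityʳ _ ⟩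
      f 0 * g 0      ≈⟨ *-congˡ g₀≈0 ⟩
      f 0 * 0#       ≈⟨ zeroʳ _ ⟩
      0#             ∎
    ⊛-tail f g g₀≈0 (suc zero)    = +-congˡ (⊛-tail (tail f) g g₀≈0 zero)
    ⊛-tail f g g₀≈0 (suc (suc n)) = +-congˡ (⊛-tail (tail f) g g₀≈0 (suc n))

    ⊛-congʳ : ∀ {f g} h → f ≋ g → f ⊛ h ≋ g ⊛ h
    ⊛-congʳ h f≋g n = sum-cong-≋ {suc n}
      (λ i → *-congʳ {x = h (n ℕ.∸ toℕ i)} (f≋g (toℕ i)))

    t·-cong : ∀ f g → f ≋ g → t· f ≋ t· g
    t·-cong f g f≋g zero    = refl
    t·-cong f g f≋g (suc n) = f≋g n

  ⊘-⊛ : ∀ f u → u 0 ≈ 1# → (f ⊘ u) ⊛ u ≋ f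
  ⊘-⊛ f u u₀≈1 zero = begin
    f 0 * u 0 + 0# ≈⟨ +-identityʳ _ ⟩
    f 0 * u 0      ≈⟨ *-congˡ u₀≈1 ⟩
    f 0 * 1#       ≈⟨ *-identityʳ _ ⟩
    f 0            ∎
  ⊘-⊛ f u u₀≈1 (suc n) = begin
    f 0 * u (suc n) + ((λ k → f (suc k) - f 0 * u (suc k)) ⊘ u ⊛ u) n
      ≈⟨ +-congˡ (⊘-⊛ (λ k → f (suc k) - f 0 * u (suc k)) u u₀≈1 n) ⟩
    f 0 * u (suc n) + (f (suc n) - f 0 * u (suc n))
      ≈⟨ a+[b-a]≈b _ _ ⟩
    f (suc n) ∎

  private
    egf-B : ∀ y → egf (λ k → B k y) ≋ exp y ⊘ tail (exp 1# ⊖ one)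
    egf-B y k = begin
      ι (1/ k !) * (fromℕ (k !) * g)   ≈⟨ *-assoc _ _ _ ⟨
      ι (1/ k !) * fromℕ (k !) * g     ≈⟨ *-congʳ (ι.*-homo _ _) ⟨
      ι (1/ k ! ℚ.* ((+ (k !)) ℚ./ 1)) * g
        ≈⟨ *-congʳ (ι.⟦⟧-cong (1/n*n≡1 (k !) {{k ℕₚ.!≢0}})) ⟩
      ι 1ℚ * g                         ≈⟨ *-congʳ ι.1#-homo ⟩
      1# * g                           ≈⟨ *-identityˡ g ⟩
      g                                ∎
      where g = (exp y ⊘ tail (exp 1# ⊖ one)) k

    constant-term : (exp 1# ⊖ one) 0 ≈ 0#
    constant-term = begin
      ι 1ℚ * 1# - 1# ≈⟨ +-congʳ (*-identityʳ _) ⟩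
      ι 1ℚ - 1#      ≈⟨ +-congʳ ι.1#-homo ⟩
      1# - 1#        ≈⟨ -‿inverseʳ 1# ⟩
      0#             ∎

    linear-term : (exp 1# ⊖ one) 1 ≈ 1#
    linear-term = begin
      ι 1ℚ * (1# * 1#) - 0# ≈⟨ +-cong (*-cong ι.1#-homo (*-identityˡ 1#)) -0#≈0# ⟩
      1# * 1# + 0#          ≈⟨ +-identityʳ _ ⟩
      1# * 1#               ≈⟨ *-identityˡ 1# ⟩
      1#                    ∎

  -- (Σ Bₖ(y) tᵏ / k!) (exp(t) - 1) = t exp(y t)
  B-egf : ∀ y → egf (λ k → B k y) ⊛ (exp 1# ⊖ one) ≋ t· exp y
  B-egf y n = begin
    (egf (λ k → B k y) ⊛ e) n                ≈⟨ ⊛-congʳ {g = exp y ⊘ tail e} e (egf-B y) n ⟩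
    ((exp y ⊘ tail e) ⊛ e) n                 ≈⟨ ⊛-tail (exp y ⊘ tail e) e constant-term n ⟩
    (t· ((exp y ⊘ tail e) ⊛ tail e)) n
      ≈⟨ t·-cong _ (exp y) (⊘-⊛ (exp y) (tail e) linear-term) n ⟩
    (t· exp y) n                             ∎
    where e = exp 1# ⊖ one

  bernoulliDifference : (q r s : ℕ) .{{_ : NonZero q}} → Carrier → ℕ → Carrier
  bernoulliDifference q r s x k =
    B k ((x + fromℕ r) /ₙ q) - B k ((x + fromℕ s) /ₙ q)

{-# OPTIONS --safe #-}

-- A sequence (aₙ) is regarded as the linear functional Xⁿ ↦ aₙ on polynomials.
-- For b the generating function of the Bernoulli polynomials says
--   b (f (X + 1) - f (X)) = f′(y) - f′(z),   y = (x + r)/q,  z = (x + s)/q.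
-- Put D = z - y, α = (1 + D)/2, β = (1 - D)/2 and recentre X so that y, z become
-- β, α; then b vanishes on even polynomials.  With
--   vᵢ = ∏_{l<i} (X² - (α + l)²),   uⱼ = ∏_{l<j} (X² - (β + l)²)
-- and f = (X + α)(X + β)(X + α + i)(X + β + j), the difference equation for a
-- polynomial with double zeros at α and β gives b (vᵢ uⱼ (f (X) - f (-X))) = 0.
-- This is a two-term recurrence, whence
--   b (X vᵢ uⱼ) = - D wᵢ w′ⱼ / (i + j + 1)
-- with explicit products wᵢ, w′ⱼ: up to diagonal factors a Hilbert matrix.
-- Eliminating as for Legendre polynomials gives monic pₖ of degree k with
-- b (X pₖ(X²) uⱼ) = 0 for j < k and = hₖ for j = k.  In the row basis
-- p₀, X p₀, p₁, X p₁, … (each pₖ taken at X²) the Hankel matrix is block upper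
-- triangular with diagonal blocks (0 hₖ; hₖ *), so H_{2m} = 0 and
-- H_{2m+1} = ∏_{k≤m} (- hₖ²).
module Submission where

open import Defs
open import Algebra.Morphism.Structures using (IsRingHomomorphism)
import Algebra.Properties.CommutativeSemiring.Exp as CommutativeSemiringExp
import Algebra.Properties.Ring as RingProperties
import Algebra.Properties.Semiring.Exp as SemiringExp
import Algebra.Properties.Semiring.Sum as SemiringSum
import Algebra.Solver.Ring as RingSolver
open import Algebra.Solver.Ring.AlmostCommutativeRing
  using (AlmostCommutativeRing; fromCommutativeRing; _-Raw-AlmostCommutative⟶_)
open import Data.Empty using (⊥-elim)
open import Data.Fin.Base using (Fin; zero; suc; toℕ; punchIn; fromℕ<)
import Data.Fin.Properties as Finₚ
open import Data.Integer.Base as ℤ using (ℤ; +_; -[1+_]; +0; +[1+_])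
import Data.Integer.Properties as ℤₚ
open import Data.Maybe.Base using (Maybe; just; nothing)
open import Data.Nat.Base as ℕ using (ℕ; zero; suc; NonZero; _<_; _≤_; z≤n; s≤s; _∸_; _!)
open import Data.Nat.Induction using (<-rec)
import Data.Nat.Properties as ℕₚ
open import Data.Nat.Properties using (m^n≢0)
open import Data.Product.Base using (_×_; _,_)
open import Data.Rational.Base as ℚ using (ℚ; 1ℚ; fromℚᵘ; toℚᵘ)
import Data.Rational.Properties as ℚₚ
open import Data.Rational.Unnormalised.Base as ℚᵘ using (mkℚᵘ; *≡*)
import Data.Rational.Unnormalised.Properties as ℚᵘₚ
open import Data.Sum.Base using (inj₁; inj₂)
open import Data.Vec.Functional using (updateAt)
open import Data.Vec.Functional.Properties using (updateAt-updates; updateAt-minimal)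
open import Function.Base using (_∘_)
open import Level using (Level; _⊔_)
open import Relation.Binary.Definitions using (tri<; tri≈; tri>)
open import Relation.Binary.PropositionalEquality as ≡ using (_≡_; _≢_; _≗_)
open import Relation.Nullary.Decidable.Core using (yes; no)

-- Because the even moments of the recentred functional vanish, there is no family of orthogonal
-- polynomials in X to diagonalise with; passing to X² and the odd moments avoids this, at the price
-- of 2 × 2 blocks. The elimination coefficients are therefore written down explicitly, and only
-- positive integers are ever inverted. The centre is the one with α + β = 1. Then β - 1 = -α and α
-- - 1 = -β, so on the factors X + α and X + β the translation of the difference equation acts like
-- a reflection. A further factor X² - c² prolongs this, turning the boundary factor X + c into X +
-- c + 1; hence the Newton products at (α + l)² and (β + l)². The Hilbert matrix is the moment
-- matrix of Lebesgue measure on [0, 1], which is where Legendre polynomials enter.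

fromℚᵘ-homo-+ : ∀ p q → fromℚᵘ (p ℚᵘ.+ q) ≡ fromℚᵘ p ℚ.+ fromℚᵘ q
fromℚᵘ-homo-+ p q = ℚₚ.toℚᵘ-injective (begin
  toℚᵘ (fromℚᵘ (p ℚᵘ.+ q))               ≈⟨ ℚₚ.toℚᵘ-fromℚᵘ (p ℚᵘ.+ q) ⟩
  p ℚᵘ.+ q                               ≈⟨ ℚᵘₚ.+-cong (ℚₚ.toℚᵘ-fromℚᵘ p) (ℚₚ.toℚᵘ-fromℚᵘ q) ⟨
  toℚᵘ (fromℚᵘ p) ℚᵘ.+ toℚᵘ (fromℚᵘ q)   ≈⟨ ℚₚ.toℚᵘ-homo-+ (fromℚᵘ p) (fromℚᵘ q) ⟨
  toℚᵘ (fromℚᵘ p ℚ.+ fromℚᵘ q)           ∎)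
  where open import Relation.Binary.Reasoning.Setoid ℚᵘₚ.≃-setoid

fromℚᵘ-homo-* : ∀ p q → fromℚᵘ (p ℚᵘ.* q) ≡ fromℚᵘ p ℚ.* fromℚᵘ q
fromℚᵘ-homo-* p q = ℚₚ.toℚᵘ-injective (begin
  toℚᵘ (fromℚᵘ (p ℚᵘ.* q))               ≈⟨ ℚₚ.toℚᵘ-fromℚᵘ (p ℚᵘ.* q) ⟩
  p ℚᵘ.* q                               ≈⟨ ℚᵘₚ.*-cong (ℚₚ.toℚᵘ-fromℚᵘ p) (ℚₚ.toℚᵘ-fromℚᵘ q) ⟨
  toℚᵘ (fromℚᵘ p) ℚᵘ.* toℚᵘ (fromℚᵘ q)   ≈⟨ ℚₚ.toℚᵘ-homo-* (fromℚᵘ p) (fromℚᵘ q) ⟨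
  toℚᵘ (fromℚᵘ p ℚ.* fromℚᵘ q)           ∎)
  where open import Relation.Binary.Reasoning.Setoid ℚᵘₚ.≃-setoid

/1-homo-+ : ∀ i j → (i ℤ.+ j) ℚ./ 1 ≡ (i ℚ./ 1) ℚ.+ (j ℚ./ 1)
/1-homo-+ i j = ≡.trans
  (ℚₚ.fromℚᵘ-cong {mkℚᵘ (i ℤ.+ j) 0} {mkℚᵘ i 0 ℚᵘ.+ mkℚᵘ j 0}
    (*≡* (≡.cong (ℤ._* + 1) (≡.sym (≡.cong₂ ℤ._+_ (ℤₚ.*-identityʳ i) (ℤₚ.*-identityʳ j))))))
  (fromℚᵘ-homo-+ (mkℚᵘ i 0) (mkℚᵘ j 0))

/1-homo-* : ∀ i j → (i ℤ.* j) ℚ./ 1 ≡ (i ℚ./ 1) ℚ.* (j ℚ./ 1)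
/1-homo-* i j = fromℚᵘ-homo-* (mkℚᵘ i 0) (mkℚᵘ j 0)

/1-homo-neg : ∀ i → (ℤ.- i) ℚ./ 1 ≡ ℚ.- (i ℚ./ 1)
/1-homo-neg +0       = ≡.refl
/1-homo-neg +[1+ n ] = ≡.refl
/1-homo-neg -[1+ n ] = ≡.sym (RingProperties.-‿involutive ℚₚ.+-*-ring (+[1+ n ] ℚ./ 1))

i/n*n≡i : ∀ i n .{{_ : NonZero n}} → (i ℚ./ n) ℚ.* ((+ n) ℚ./ 1) ≡ i ℚ./ 1
i/n*n≡i i n@(suc n-1) = ≡.trans
  (≡.sym (fromℚᵘ-homo-* (mkℚᵘ i n-1) (mkℚᵘ (+ n) 0)))
  (ℚₚ.fromℚᵘ-cong {mkℚᵘ i n-1 ℚᵘ.* mkℚᵘ (+ n) 0} {mkℚᵘ i 0}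
    (*≡* (≡.trans (ℤₚ.*-identityʳ _) (≡.cong (λ k → i ℤ.* + k) (≡.sym (ℕₚ.*-identityʳ n))))))

-- Even and odd indices.

double : ℕ → ℕ
double zero    = zero
double (suc n) = suc (suc (double n))

parity-elim : ∀ {p} (P : ℕ → Set p) → (∀ k → P (double k)) → (∀ k → P (suc (double k))) → ∀ n → P n
parity-elim P ev od zero          = ev 0
parity-elim P ev od (suc zero)    = od 0
parity-elim P ev od (suc (suc n)) = parity-elim (λ k → P (suc (suc k))) (ev ∘ suc) (od ∘ suc) n

interleave : ∀ {x} {X : Set x} → (ℕ → X) → (ℕ → X) → ℕ → X
interleave f g zero          = f 0
interleave f g (suc zero)    = g 0
interleave f g (suc (suc n)) = interleave (f ∘ suc) (g ∘ suc) n

interleave-even : ∀ {x} {X : Set x} (f g : ℕ → X) k → interleave f g (double k) ≡ f k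
interleave-even f g zero    = ≡.refl
interleave-even f g (suc k) = interleave-even (f ∘ suc) (g ∘ suc) k

interleave-odd : ∀ {x} {X : Set x} (f g : ℕ → X) k → interleave f g (suc (double k)) ≡ g k
interleave-odd f g zero    = ≡.refl
interleave-odd f g (suc k) = interleave-odd (f ∘ suc) (g ∘ suc) k

2*n≡double : ∀ n → 2 ℕ.* n ≡ double n
2*n≡double zero    = ≡.refl
2*n≡double (suc n) = ≡.cong suc (≡.trans (ℕₚ.+-suc n (n ℕ.+ 0)) (≡.cong suc (2*n≡double n)))

module Proof {c ℓ : Level} (A : CommutativeℚAlgebra c ℓ) where

  open CommutativeℚAlgebra A hiding (zero)
  open ℚAlgebraDefs A
  open CommutativeSemiringExp commutativeSemiring using (^-distrib-*)
  open RingProperties ring using (-‿involutive; -0#≈0#; -1*x≈-x)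
  open SemiringExp semiring using (_^_; ^-congˡ; ^-congʳ; ^-assocʳ)
  open SemiringSum semiring using (sum; sum-cong-≋; ∑-distrib-+; *-distribˡ-sum)
  open import Relation.Binary.Reasoning.Setoid setoid

  module ι = IsRingHomomorphism ι-isRingHomomorphism

  -- Sends 0 and 1 to 0# and 1# on the nose, so that the solver accepts the
  -- constants of the ring as they are written.
  fromℤ : ℤ → Carrier
  fromℤ +0        = 0#
  fromℤ (+ 1)     = 1#
  fromℤ i         = ι (i ℚ./ 1)

  fromℤ≈ι : ∀ i → fromℤ i ≈ ι (i ℚ./ 1)
  fromℤ≈ι +0               = sym ι.0#-homo
  fromℤ≈ι (+ 1)            = sym ι.1#-homo
  fromℤ≈ι (+ suc (suc n))  = refl
  fromℤ≈ι -[1+ n ]         = refl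

  fromℤ-homo-+ : ∀ i j → fromℤ (i ℤ.+ j) ≈ fromℤ i + fromℤ j
  fromℤ-homo-+ i j = begin
    fromℤ (i ℤ.+ j)                ≈⟨ fromℤ≈ι (i ℤ.+ j) ⟩
    ι ((i ℤ.+ j) ℚ./ 1)            ≈⟨ ι.⟦⟧-cong (/1-homo-+ i j) ⟩
    ι ((i ℚ./ 1) ℚ.+ (j ℚ./ 1))    ≈⟨ ι.+-homo _ _ ⟩
    ι (i ℚ./ 1) + ι (j ℚ./ 1)      ≈⟨ +-cong (fromℤ≈ι i) (fromℤ≈ι j) ⟨
    fromℤ i + fromℤ j              ∎

  fromℤ-homo-* : ∀ i j → fromℤ (i ℤ.* j) ≈ fromℤ i * fromℤ j
  fromℤ-homo-* i j = begin
    fromℤ (i ℤ.* j)                ≈⟨ fromℤ≈ι (i ℤ.* j) ⟩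
    ι ((i ℤ.* j) ℚ./ 1)            ≈⟨ ι.⟦⟧-cong (/1-homo-* i j) ⟩
    ι ((i ℚ./ 1) ℚ.* (j ℚ./ 1))    ≈⟨ ι.*-homo _ _ ⟩
    ι (i ℚ./ 1) * ι (j ℚ./ 1)      ≈⟨ *-cong (fromℤ≈ι i) (fromℤ≈ι j) ⟨
    fromℤ i * fromℤ j              ∎

  fromℤ-homo-neg : ∀ i → fromℤ (ℤ.- i) ≈ - fromℤ i
  fromℤ-homo-neg i = begin
    fromℤ (ℤ.- i)         ≈⟨ fromℤ≈ι (ℤ.- i) ⟩
    ι ((ℤ.- i) ℚ./ 1)     ≈⟨ ι.⟦⟧-cong (/1-homo-neg i) ⟩
    ι (ℚ.- (i ℚ./ 1))     ≈⟨ ι.-‿homo _ ⟩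
    - ι (i ℚ./ 1)         ≈⟨ -‿cong (fromℤ≈ι i) ⟨
    - fromℤ i             ∎

  private
    almostCommutativeRing : AlmostCommutativeRing c ℓ
    almostCommutativeRing = fromCommutativeRing commutativeRing

    ℤ⟶A : ℤ.+-*-rawRing -Raw-AlmostCommutative⟶ almostCommutativeRing
    ℤ⟶A = record
      { ⟦_⟧    = fromℤ
      ; +-homo = fromℤ-homo-+
      ; *-homo = fromℤ-homo-*
      ; -‿homo = fromℤ-homo-neg
      ; 0-homo = refl
      ; 1-homo = refl
      }

    _≟_ : ∀ i j → Maybe (fromℤ i ≈ fromℤ j)
    i ≟ j with i ℤₚ.≟ j
    ... | yes ≡.refl = just refl
    ... | no  _      = nothing

  open RingSolver ℤ.+-*-rawRing almostCommutativeRing ℤ⟶A _≟_ public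
    using (solve; _:=_; _:+_; _:*_; _:-_; :-_; con)

  -- Natural numbers in the algebra and their inverses.

  fromℕ-0 : fromℕ 0 ≈ 0#
  fromℕ-0 = ι.0#-homo

  fromℕ-1 : fromℕ 1 ≈ 1#
  fromℕ-1 = ι.1#-homo

  fromℕ-suc : ∀ n → fromℕ (suc n) ≈ 1# + fromℕ n
  fromℕ-suc n = begin
    fromℕ (suc n)                        ≈⟨ ι.⟦⟧-cong (/1-homo-+ (+ 1) (+ n)) ⟩
    ι (((+ 1) ℚ./ 1) ℚ.+ ((+ n) ℚ./ 1))  ≈⟨ ι.+-homo _ _ ⟩
    ι ((+ 1) ℚ./ 1) + fromℕ n            ≈⟨ +-congʳ fromℕ-1 ⟩
    1# + fromℕ n                         ∎

  fromℕ-+ : ∀ m n → fromℕ (m ℕ.+ n) ≈ fromℕ m + fromℕ n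
  fromℕ-+ m n = trans (ι.⟦⟧-cong (/1-homo-+ (+ m) (+ n))) (ι.+-homo _ _)

  fromℕ-* : ∀ m n → fromℕ (m ℕ.* n) ≈ fromℕ m * fromℕ n
  fromℕ-* m n = begin
    ι ((+ (m ℕ.* n)) ℚ./ 1)              ≈⟨ ι.⟦⟧-cong (≡.cong (ℚ._/ 1) (ℤₚ.pos-* m n)) ⟩
    ι (((+ m) ℤ.* (+ n)) ℚ./ 1)          ≈⟨ ι.⟦⟧-cong (/1-homo-* (+ m) (+ n)) ⟩
    ι (((+ m) ℚ./ 1) ℚ.* ((+ n) ℚ./ 1))  ≈⟨ ι.*-homo _ _ ⟩
    fromℕ m * fromℕ n                    ∎

  1/-inverse : ∀ n .{{_ : NonZero n}} → ι ((+ 1) ℚ./ n) * fromℕ n ≈ 1#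
  1/-inverse n = begin
    ι ((+ 1) ℚ./ n) * fromℕ n            ≈⟨ ι.*-homo _ _ ⟨
    ι ((+ 1) ℚ./ n ℚ.* ((+ n) ℚ./ 1))    ≈⟨ ι.⟦⟧-cong (1/n*n≡1 n) ⟩
    ι 1ℚ                                 ≈⟨ ι.1#-homo ⟩
    1#                                   ∎

  1/suc : ℕ → Carrier
  1/suc n = ι ((+ 1) ℚ./ suc n)

  1/suc-inverse : ∀ n → 1/suc n * (1# + fromℕ n) ≈ 1#
  1/suc-inverse n = trans (*-congˡ (sym (fromℕ-suc n))) (1/-inverse (suc n))

  -- `A` need not be a domain, so cancellation goes through an explicit inverse; in every use `v` is
  -- a positive integer.
  invertible-cancelˡ : ∀ u v {x y} → u * v ≈ 1# → v * x ≈ v * y → x ≈ y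
  invertible-cancelˡ u v {x} {y} uv≈1 vx≈vy = begin
    x            ≈⟨ *-identityˡ x ⟨
    1# * x       ≈⟨ *-congʳ uv≈1 ⟨
    u * v * x    ≈⟨ *-assoc u v x ⟩
    u * (v * x)  ≈⟨ *-congˡ vx≈vy ⟩
    u * (v * y)  ≈⟨ *-assoc u v y ⟨
    u * v * y    ≈⟨ *-congʳ uv≈1 ⟩
    1# * y       ≈⟨ *-identityˡ y ⟩
    y            ∎

  1+fromℕ-cancelˡ : ∀ n {x y} → (1# + fromℕ n) * x ≈ (1# + fromℕ n) * y → x ≈ y
  1+fromℕ-cancelˡ n = invertible-cancelˡ (1/suc n) (1# + fromℕ n) (1/suc-inverse n)

  -- Determinants

  sum-zero : ∀ {n} {f : Fin n → Carrier} → (∀ i → f i ≈ 0#) → sum f ≈ 0#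
  sum-zero {zero}  f≈0 = refl
  sum-zero {suc n} f≈0 = trans (+-cong (f≈0 zero) (sum-zero (f≈0 ∘ suc))) (+-identityˡ 0#)

  sum-linear : ∀ {n} t (f g : Fin n → Carrier) → sum (λ i → f i + t * g i) ≈ sum f + t * sum g
  sum-linear t f g = trans (∑-distrib-+ f (λ i → t * g i)) (+-congˡ (sym (*-distribˡ-sum t g)))

  minor : ∀ {n} → Matrix (suc n) → Fin (suc n) → Matrix n
  minor M j i k = M (suc i) (punchIn j k)

  det-cong : ∀ {n} {M N : Matrix n} → (∀ i j → M i j ≈ N i j) → det M ≈ det N
  det-cong {zero}  M≈N = refl
  det-cong {suc n} M≈N = sum-cong-≋ {suc n} (λ j →
    *-cong (*-congˡ {(- 1#) ^ toℕ j} (M≈N zero j)) (det-cong (λ i k → M≈N (suc i) (punchIn j k))))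

  det-minors-zero : ∀ {n} {M : Matrix (suc n)} → (∀ j → det (minor M j) ≈ 0#) → det M ≈ 0#
  det-minors-zero {n} {M} minors≈0 = sum-zero {suc n} (λ j →
    trans (*-congˡ {(- 1#) ^ toℕ j * M zero j} (minors≈0 j)) (zeroʳ _))

  det-zero-column : ∀ {n} {M : Matrix (suc n)} → (∀ i → M i zero ≈ 0#) → det M ≈ 0#
  det-zero-column {n} {M} col≈0 = sum-zero {suc n} term
    where
    term : ∀ j → (- 1#) ^ toℕ j * M zero j * det (minor M j) ≈ 0#
    term zero = trans (*-congʳ (trans (*-congˡ (col≈0 zero)) (zeroʳ _))) (zeroˡ _)
    term (suc {suc _} j) = trans (*-congˡ (det-zero-column {M = minor M (suc j)} (λ i → col≈0
        (suc i)))) (zeroʳ _)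

  det-first-column : ∀ {n} {M : Matrix (suc n)} → (∀ i → M (suc i) zero ≈ 0#) →
                     det M ≈ M zero zero * det (minor M zero)
  det-first-column {n} {M} col≈0 = begin
    1# * M zero zero * det (minor M zero)
      + sum (λ (j : Fin n) → (- 1#) ^ toℕ (suc j) * M zero (suc j) * det (minor M (suc j)))
      ≈⟨ +-cong (*-congʳ (*-identityˡ _)) (sum-zero {n} (term {M = M} {col≈0})) ⟩
    M zero zero * det (minor M zero) + 0#  ≈⟨ +-identityʳ _ ⟩
    M zero zero * det (minor M zero)       ∎
    where
    term : ∀ {n} {M : Matrix (suc n)} {col≈0 : ∀ i → M (suc i) zero ≈ 0#} (j : Fin n) →
           (- 1#) ^ toℕ (suc j) * M zero (suc j) * det (minor M (suc j)) ≈ 0#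
    term {suc n} {M} {col≈0} j =
      trans (*-congˡ (det-zero-column {M = minor M (suc j)} col≈0)) (zeroʳ _)

  -- Only column one of row zero contributes: the corner is zero, and deleting any later column
  -- leaves both initial columns in place, which have too few nonzero entries below row zero. The
  -- entry at position (1, 1) is unconstrained.
  det-antidiagonal-block : ∀ {n} {M : Matrix (suc (suc n))} → M zero zero ≈ 0# →
    (∀ i → M (suc (suc i)) zero ≈ 0#) → (∀ i → M (suc (suc i)) (suc zero) ≈ 0#) →
    det M ≈ - (M zero (suc zero) * M (suc zero) zero * det (λ i k → M (suc (suc i)) (suc (suc k))))
  det-antidiagonal-block {n} {M} corner≈0 col₀≈0 col₁≈0 = begin
    1# * M zero zero * det (minor M zero)
      + (- 1# * 1# * M zero (suc zero) * det (minor M (suc zero))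
        + sum (λ (j : Fin n) → (- 1#) ^ toℕ (suc (suc j)) * M zero (suc (suc j)) * det (minor M
            (suc (suc j)))))
      ≈⟨ +-cong (trans (*-congʳ (trans (*-congˡ corner≈0) (zeroʳ _))) (zeroˡ _))
          (+-cong (*-congˡ (det-first-column {M = minor M (suc zero)} col₀≈0))
            (sum-zero {n} (term {M = M} col₀≈0 col₁≈0))) ⟩
    0# + (- 1# * 1# * M zero (suc zero) * (M (suc zero) zero * D) + 0#)
      ≈⟨ solve 3 (λ x y d → con (+ 0) :+ (:- con (+ 1) :* con (+ 1) :* x :* (y :* d) :+ con (+ 0))
                            := :- (x :* y :* d)) refl _ _ D ⟩
    - (M zero (suc zero) * M (suc zero) zero * D) ∎
    where
    D = det (λ i k → M (suc (suc i)) (suc (suc k)))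
    term : ∀ {n} {M : Matrix (suc (suc n))} → (∀ i → M (suc (suc i)) zero ≈ 0#) →
           (∀ i → M (suc (suc i)) (suc zero) ≈ 0#) → (j : Fin n) →
           (- 1#) ^ toℕ (suc (suc j)) * M zero (suc (suc j)) * det (minor M (suc (suc j))) ≈ 0#
    term {suc n} {M} col₀≈0 col₁≈0 j = trans (*-congˡ
      (trans (det-first-column {M = minor M (suc (suc j))} col₀≈0)
        (trans (*-congˡ (det-zero-column {M = minor (minor M (suc (suc j))) zero} col₁≈0))
            (zeroʳ _)))) (zeroʳ _)

  det-linear : ∀ {n} (r : Fin n) t {P M N : Matrix n} →
               (∀ j → P r j ≈ M r j + t * N r j) →
               (∀ i → i ≢ r → ∀ j → P i j ≈ M i j) →
               (∀ i → i ≢ r → ∀ j → P i j ≈ N i j) →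
               det P ≈ det M + t * det N
  det-linear {suc n} zero t {P} {M} {N} row≈ P≈M P≈N = begin
    det P
      ≈⟨ sum-cong-≋ {suc n} (λ j → begin
        (- 1#) ^ toℕ j * P zero j * det (minor P j)
          ≈⟨ *-congʳ (*-congˡ (row≈ j)) ⟩
        (- 1#) ^ toℕ j * (M zero j + t * N zero j) * det (minor P j)
          ≈⟨ solve 5 (λ e x y t d → e :* (x :+ t :* y) :* d := e :* x :* d :+ t :* (e :* y :* d))
               refl _ _ _ _ _ ⟩
        (- 1#) ^ toℕ j * M zero j * det (minor P j) + t * ((- 1#) ^ toℕ j * N zero j * det (minor P j))
          ≈⟨ +-cong (*-congˡ (det-cong (λ i k → P≈M (suc i) (λ ()) (punchIn j k))))
                    (*-congˡ (*-congˡ (det-cong (λ i k → P≈N (suc i) (λ ()) (punchIn j k))))) ⟩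
        (- 1#) ^ toℕ j * M zero j * det (minor M j) + t * ((- 1#) ^ toℕ j * N zero j * det (minor N j))
          ∎) ⟩
    sum (λ j → (- 1#) ^ toℕ j * M zero j * det (minor M j)
             + t * ((- 1#) ^ toℕ j * N zero j * det (minor N j)))
      ≈⟨ sum-linear {suc n} t (λ j → (- 1#) ^ toℕ j * M zero j * det (minor M j)) (λ j →
          (- 1#) ^ toℕ j * N zero j * det (minor N j)) ⟩
    det M + t * det N ∎
  det-linear {suc n} (suc r) t {P} {M} {N} row≈ P≈M P≈N = begin
    det P
      ≈⟨ sum-cong-≋ {suc n} (λ j → begin
        (- 1#) ^ toℕ j * P zero j * det (minor P j)
          ≈⟨ *-congˡ (det-linear r t {minor P j} {minor M j} {minor N j} (λ k → row≈ (punchIn j k))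
               (λ i i≢r k → P≈M (suc i) (i≢r ∘ Finₚ.suc-injective) (punchIn j k))
               (λ i i≢r k → P≈N (suc i) (i≢r ∘ Finₚ.suc-injective) (punchIn j k))) ⟩
        (- 1#) ^ toℕ j * P zero j * (det (minor M j) + t * det (minor N j))
          ≈⟨ solve 5 (λ e x t d d′ → e :* x :* (d :+ t :* d′) := e :* x :* d :+ t :* (e :* x :* d′))
               refl _ _ _ _ _ ⟩
        (- 1#) ^ toℕ j * P zero j * det (minor M j) + t * ((- 1#) ^ toℕ j * P zero j * det (minor N j))
          ≈⟨ +-cong (*-congʳ (*-congˡ (P≈M zero (λ ()) j))) (*-congˡ (*-congʳ (*-congˡ (P≈N zero
              (λ ()) j)))) ⟩
        (- 1#) ^ toℕ j * M zero j * det (minor M j) + t * ((- 1#) ^ toℕ j * N zero j * det (minor N j))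
          ∎) ⟩
    sum (λ j → (- 1#) ^ toℕ j * M zero j * det (minor M j)
             + t * ((- 1#) ^ toℕ j * N zero j * det (minor N j)))
      ≈⟨ sum-linear {suc n} t (λ j → (- 1#) ^ toℕ j * M zero j * det (minor M j)) (λ j →
          (- 1#) ^ toℕ j * N zero j * det (minor N j)) ⟩
    det M + t * det N ∎

  -- The Laplace expansion along the first two rows p, q; D stands for the
  -- determinant of the remaining rows as a function of the chosen columns.
  module _ where
    private
      Respects : ∀ {m n} → ((Fin m → Fin n) → Carrier) → Set ℓ
      Respects {m} {n} D = ∀ {f g : Fin m → Fin n} → f ≗ g → D f ≈ D g

    expand₁ : ∀ {n} → (Fin (suc n) → Carrier) → ((Fin n → Fin (suc n)) → Carrier) → Carrier
    expand₁ {n} q D = sum (λ (k : Fin (suc n)) → (- 1#) ^ toℕ k * q k * D (punchIn k))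

    expand₂ : ∀ {n} (p q : Fin (suc (suc n)) → Carrier) →
              ((Fin n → Fin (suc (suc n))) → Carrier) → Carrier
    expand₂ {n} p q D = sum (λ (j : Fin (suc (suc n))) →
      (- 1#) ^ toℕ j * p j * sum (λ (k : Fin (suc n)) →
        (- 1#) ^ toℕ k * q (punchIn j k) * D (punchIn j ∘ punchIn k)))

    private
      lift : ∀ {m n} → (Fin m → Fin n) → Fin (suc m) → Fin (suc n)
      lift f zero    = zero
      lift f (suc i) = suc (f i)

      punch-lift : ∀ {n} (j : Fin (suc (suc n))) (k : Fin (suc n)) →
                   punchIn (suc j) ∘ punchIn (suc k) ≗ lift (punchIn j ∘ punchIn k)
      punch-lift j k zero    = ≡.refl
      punch-lift j k (suc i) = ≡.refl

      rest : ∀ {n} (p q : Fin (suc (suc n)) → Carrier) →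
              ((Fin n → Fin (suc (suc n))) → Carrier) → Carrier
      rest {zero}  p q D = 0#
      rest {suc n} p q D = expand₂ (p ∘ suc) (q ∘ suc) (D ∘ lift)

      row : ∀ {n} → (Fin (suc (suc n)) → Carrier) → ((Fin n → Fin (suc (suc n))) → Carrier) → Carrier
      row q D = expand₁ (q ∘ suc) (λ f → D (suc ∘ f))

      tail-terms : ∀ {n} (p q : Fin (suc (suc n)) → Carrier) D → Respects D →
        sum (λ (j : Fin (suc n)) → (- 1#) ^ toℕ j * p (suc j) *
          sum (λ (k : Fin n) → (- 1#) ^ toℕ k * q (suc (punchIn j k)) * D (punchIn
              (suc j) ∘ punchIn (suc k))))
        ≈ rest p q D
      tail-terms {zero}  p q D resp = trans (+-identityʳ _) (zeroʳ _)
      tail-terms {suc n} p q D resp = sum-cong-≋ {suc (suc n)} (λ j →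
        *-congˡ {(- 1#) ^ toℕ j * p (suc j)} (sum-cong-≋ {suc n} (λ k →
          *-congˡ {(- 1#) ^ toℕ k * q (suc (punchIn j k))} (resp (punch-lift j k)))))

    -- Sorts the terms by which row uses column zero: the first, the second, or neither (`rest`). If
    -- the second does, the first row sits in a later column, and its index counts column zero; this
    -- extra factor -1 is the minus sign.
    expand₂-peel : ∀ {n} (p q : Fin (suc (suc n)) → Carrier) D → Respects D →
      expand₂ p q D ≈ p zero * row q D - q zero * row p D + rest p q D
    expand₂-peel {n} p q D resp = begin
      1# * p zero * row q D + sum (λ (j : Fin (suc n)) →
        - 1# * (- 1#) ^ toℕ j * p (suc j) * (1# * q zero * D (suc ∘ punchIn j) + inner j))
        ≈⟨ +-congˡ (sum-cong-≋ {suc n} (λ j → begin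
          - 1# * e j * p (suc j) * (1# * q zero * D (suc ∘ punchIn j) + inner j)
            ≈⟨ *-congˡ (+-congˡ (inner≈ j)) ⟩
          - 1# * e j * p (suc j) * (1# * q zero * D (suc ∘ punchIn j) + - 1# * inner′ j)
            ≈⟨ solve 5 (λ e p q d i → :- con (+ 1) :* e :* p :* (con (+ 1) :* q :* d :+ :- con
                (+ 1) :* i)
                  := e :* p :* i :+ (:- q) :* (e :* p :* d)) refl (e j) (p (suc j)) (q zero) (D
                      (suc ∘ punchIn j)) (inner′ j) ⟩
          e j * p (suc j) * inner′ j + (- q zero) * (e j * p (suc j) * D (suc ∘ punchIn j)) ∎)) ⟩
      1# * p zero * row q D + sum (λ (j : Fin (suc n)) →
        e j * p (suc j) * inner′ j + (- q zero) * (e j * p (suc j) * D (suc ∘ punchIn j)))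
        ≈⟨ +-congˡ (sum-linear {suc n} (- q zero) (λ j → e j * p (suc j) * inner′ j)
            (λ j → e j * p (suc j) * D (suc ∘ punchIn j))) ⟩
      1# * p zero * row q D + (sum (λ j → e j * p (suc j) * inner′ j) + (- q zero) * row p D)
        ≈⟨ +-congˡ (+-congʳ (tail-terms p q D resp)) ⟩
      1# * p zero * row q D + (rest p q D + (- q zero) * row p D)
        ≈⟨ solve 5 (λ p r q r′ t → con (+ 1) :* p :* r :+ (t :+ (:- q) :* r′) := p :* r :- q :* r′ :+ t)
             refl (p zero) (row q D) (q zero) (row p D) (rest p q D) ⟩
      p zero * row q D - q zero * row p D + rest p q D ∎
      where
      e : Fin (suc n) → Carrier
      e j = (- 1#) ^ toℕ j
      inner inner′ : Fin (suc n) → Carrier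
      inner j = sum (λ (k : Fin n) → - 1# * (- 1#) ^ toℕ k * q (suc (punchIn j k)) * D (punchIn
          (suc j) ∘ punchIn (suc k)))
      inner′ j = sum (λ (k : Fin n) → (- 1#) ^ toℕ k * q (suc (punchIn j k)) * D (punchIn
          (suc j) ∘ punchIn (suc k)))
      inner≈ : ∀ j → inner j ≈ - 1# * inner′ j
      inner≈ j = trans (sum-cong-≋ {n} (λ k → trans (*-congʳ (*-assoc _ _ _)) (*-assoc _ _ _)))
                       (sym (*-distribˡ-sum {n} (- 1#) _))

    -- Exchanging the rows swaps the two explicit terms of `expand₂-peel`, which have opposite
    -- signs, and `rest` is an expansion of the same kind over one column fewer.
    expand₂-antisym : ∀ {n} (p q : Fin (suc (suc n)) → Carrier) D → Respects D →
                      expand₂ p q D ≈ - expand₂ q p D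
    expand₂-antisym {n} p q D resp = begin
      expand₂ p q D
        ≈⟨ expand₂-peel p q D resp ⟩
      p zero * row q D - q zero * row p D + rest p q D
        ≈⟨ +-congˡ (rest-antisym p q D resp) ⟩
      p zero * row q D - q zero * row p D + (- rest q p D)
        ≈⟨ solve 5 (λ p r q r′ t → p :* r :- q :* r′ :+ (:- t) := :- (q :* r′ :- p :* r :+ t))
             refl (p zero) (row q D) (q zero) (row p D) (rest q p D) ⟩
      - (q zero * row p D - p zero * row q D + rest q p D)
        ≈⟨ -‿cong (expand₂-peel q p D resp) ⟨
      - expand₂ q p D ∎
      where
      lift-resp : ∀ {m n} {f g : Fin m → Fin n} → f ≗ g → lift f ≗ lift g
      lift-resp f≗g zero    = ≡.refl
      lift-resp f≗g (suc i) = ≡.cong suc (f≗g i)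
      rest-antisym : ∀ {n} (p q : Fin (suc (suc n)) → Carrier) D → Respects D →
                     rest p q D ≈ - rest q p D
      rest-antisym {zero}  p q D resp = sym -0#≈0#
      rest-antisym {suc n} p q D resp =
        expand₂-antisym (p ∘ suc) (q ∘ suc) (D ∘ lift) (resp ∘ lift-resp)

  swap : ∀ {n} → Matrix (suc (suc n)) → Matrix (suc (suc n))
  swap M zero          = M (suc zero)
  swap M (suc zero)    = M zero
  swap M (suc (suc i)) = M (suc (suc i))

  det-swap : ∀ {n} (M : Matrix (suc (suc n))) → det M ≈ - det (swap M)
  det-swap M = expand₂-antisym (M zero) (M (suc zero)) (λ f → det (λ i k → M (suc (suc i)) (f k)))
    (λ f≗g → det-cong (λ i k → reflexive (≡.cong (M (suc (suc i))) (f≗g k))))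

  x≈-x⇒x≈0 : ∀ {x} → x ≈ - x → x ≈ 0#
  x≈-x⇒x≈0 {x} x≈-x = 1+fromℕ-cancelˡ 1 (begin
    (1# + fromℕ 1) * x   ≈⟨ *-congʳ (+-congˡ fromℕ-1) ⟩
    (1# + 1#) * x        ≈⟨ solve 1 (λ x → (con (+ 1) :+ con (+ 1)) :* x := x :+ x) refl x ⟩
    x + x                ≈⟨ +-congˡ x≈-x ⟩
    x - x                ≈⟨ -‿inverseʳ x ⟩
    0#                   ≈⟨ zeroʳ _ ⟨
    (1# + fromℕ 1) * 0#  ∎)

  -- Rows 0 and 1 are the base case, by antisymmetry and the invertibility of 2. If only one of the
  -- equal rows is row 0, swapping it with row 1 makes both survive in every minor of the expansion.
  det-equal-rows : ∀ {n} {M : Matrix n} (i j : Fin n) → toℕ i < toℕ j →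
                   (∀ k → M i k ≈ M j k) → det M ≈ 0#
  det-equal-rows {suc (suc n)} {M} zero (suc zero) _ eq = x≈-x⇒x≈0 (trans (det-swap M) (-‿cong
      (det-cong swap≈)))
    where
    swap≈ : ∀ i k → swap M i k ≈ M i k
    swap≈ zero          k = sym (eq k)
    swap≈ (suc zero)    k = eq k
    swap≈ (suc (suc i)) k = refl
  det-equal-rows {suc (suc n)} {M} zero (suc (suc j)) _ eq = begin
    det M           ≈⟨ det-swap M ⟩
    - det (swap M)  ≈⟨ -‿cong (det-minors-zero {M = swap M} (λ k →
                         det-equal-rows {M = minor (swap M) k} zero (suc j) (s≤s z≤n) (λ l → eq
                             (punchIn k l)))) ⟩
    - 0#            ≈⟨ -0#≈0# ⟩
    0#              ∎
  det-equal-rows {suc n} {M} (suc i) (suc j) (s≤s i<j) eq =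
    det-minors-zero {M = M} (λ k → det-equal-rows {M = minor M k} i j i<j (λ l → eq (punchIn k l)))

  -- The index forces exactly one coefficient for each of `ρ 0`, ..., `ρ (n - 1)`, the last one
  -- outermost. Thus `Span ρ d (σ d ⊖ ρ d)` for all `d` says that σ is a unitriangular transform of
  -- ρ.
  data Span (ρ : ℕ → Series) : ℕ → Series → Set (c ⊔ ℓ) where
    none : ∀ {a} → (∀ j → a j ≈ 0#) → Span ρ 0 a
    more : ∀ {n a a′} t → Span ρ n a′ → (∀ j → a j ≈ a′ j + t * ρ n j) → Span ρ (suc n) a

  toMatrix : ∀ {n} → (ℕ → Series) → Matrix n
  toMatrix ρ i j = ρ (toℕ i) (toℕ j)

  private
    -- By linearity in row `p`, the outermost multiple of `ρ l` splits off a determinant in which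
    -- row `p` repeats the earlier row `l`.
    det-add-span : ∀ {n ρ l a} (p : Fin n) (P M : Matrix n) → Span ρ l a → l ≤ toℕ p →
      (∀ i → toℕ i < toℕ p → ∀ j → M i j ≈ ρ (toℕ i) (toℕ j)) →
      (∀ j → P p j ≈ M p j + a (toℕ j)) →
      (∀ i → i ≢ p → ∀ j → P i j ≈ M i j) → det P ≈ det M
    det-add-span {n} p P M (none a≈0) _ M≈ρ row≈ P≈M = det-cong entry
      where
      entry : ∀ i j → P i j ≈ M i j
      entry i j with i Finₚ.≟ p
      ... | yes ≡.refl = trans (row≈ j) (trans (+-congˡ (a≈0 (toℕ j))) (+-identityʳ _))
      ... | no i≢p = P≈M i i≢p j
    det-add-span {n} {ρ} {suc l} {a} p P M (more {a′ = a′} t span a≈) l<p M≈ρ row≈ P≈M = begin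
      det P               ≈⟨ det-linear p t row-P (off-P u) (off-P v) ⟩
      det M′ + t * det N  ≈⟨ +-cong (det-add-span p M′ M span (ℕₚ.<⇒≤ l<p) M≈ρ
                                       (λ j → reflexive (at-p u j))
                                       (λ i i≢p j → reflexive (off-p u i i≢p j)))
                                    (*-congˡ (det-equal-rows {M = N} l′ p l′<p rows≈)) ⟩
      det M + t * 0#      ≈⟨ +-congˡ (zeroʳ t) ⟩
      det M + 0#          ≈⟨ +-identityʳ _ ⟩
      det M               ∎
      where
      u v : Fin n → Carrier
      u j = M p j + a′ (toℕ j)
      v j = ρ l (toℕ j)
      M′ N : Matrix n
      M′ = updateAt M p (λ _ → u)
      N  = updateAt M p (λ _ → v)
      l<n = ℕₚ.<-trans l<p (Finₚ.toℕ<n p)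
      l′ = fromℕ< l<n
      l′≡l : toℕ l′ ≡ l
      l′≡l = Finₚ.toℕ-fromℕ< l<n
      l′<p : toℕ l′ < toℕ p
      l′<p = ≡.subst (_< toℕ p) (≡.sym l′≡l) l<p
      at-p : ∀ w j → updateAt M p (λ _ → w) p j ≡ w j
      at-p w j = ≡.cong (λ f → f j) (updateAt-updates p M)
      off-p : ∀ w i → i ≢ p → ∀ j → updateAt M p (λ _ → w) i j ≡ M i j
      off-p w i i≢p j = ≡.cong (λ f → f j) (updateAt-minimal i p M i≢p)
      off-P : ∀ w i → i ≢ p → ∀ j → P i j ≈ updateAt M p (λ _ → w) i j
      off-P w i i≢p j = trans (P≈M i i≢p j) (reflexive (≡.sym (off-p w i i≢p j)))
      row-P : ∀ j → P p j ≈ M′ p j + t * N p j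
      row-P j = begin
        P p j                              ≈⟨ row≈ j ⟩
        M p j + a (toℕ j)                  ≈⟨ +-congˡ (a≈ (toℕ j)) ⟩
        M p j + (a′ (toℕ j) + t * v j)     ≈⟨ +-assoc _ _ _ ⟨
        u j + t * v j                      ≈⟨ +-cong (reflexive (at-p u j)) (*-congˡ (reflexive
            (at-p v j))) ⟨
        M′ p j + t * N p j                 ∎
      rows≈ : ∀ k → N l′ k ≈ N p k
      rows≈ k = begin
        N l′ k            ≈⟨ reflexive (off-p v l′ (λ l′≡p → ℕₚ.<⇒≢ l′<p (≡.cong toℕ l′≡p)) k) ⟩
        M l′ k            ≈⟨ M≈ρ l′ l′<p k ⟩
        ρ (toℕ l′) (toℕ k) ≈⟨ reflexive (≡.cong (λ i → ρ i (toℕ k)) l′≡l) ⟩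
        v k               ≈⟨ reflexive (at-p v k) ⟨
        N p k             ∎

    mix : (ρ σ : ℕ → Series) → ℕ → ℕ → Series
    mix ρ σ zero    i       = σ i
    mix ρ σ (suc p) zero    = ρ 0
    mix ρ σ (suc p) (suc i) = mix (ρ ∘ suc) (σ ∘ suc) p i

    mix-< : ∀ {ρ σ} p i → i < p → mix ρ σ p i ≡ ρ i
    mix-< (suc p) zero    _         = ≡.refl
    mix-< (suc p) (suc i) (s≤s i<p) = mix-< p i i<p

    mix-≥ : ∀ {ρ σ} p i → p ≤ i → mix ρ σ p i ≡ σ i
    mix-≥ zero    i       _         = ≡.refl
    mix-≥ (suc p) (suc i) (s≤s p≤i) = mix-≥ p i p≤i

  -- Rows are exchanged from the top down: when row `p` is treated, all rows above it already belong
  -- to ρ, which is what the span is expressed in. `mix ρ σ p` is the intermediate state.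
  det-unitriangular : ∀ n {ρ σ : ℕ → Series} → (∀ d → Span ρ d (σ d ⊖ ρ d)) →
                      det {n} (toMatrix σ) ≈ det {n} (toMatrix ρ)
  det-unitriangular n {ρ} {σ} span = trans (go n ℕₚ.≤-refl)
    (det-cong (λ i j → reflexive (≡.cong (λ f → f (toℕ j)) (mix-< n (toℕ i) (Finₚ.toℕ<n i)))))
    where
    step : ∀ p → p < n → det {n} (toMatrix (mix ρ σ p)) ≈ det {n} (toMatrix (mix ρ σ (suc p)))
    step p p<n = det-add-span {n} {ρ} {p} {σ p ⊖ ρ p} p′ (toMatrix (mix ρ σ p)) (toMatrix (mix ρ σ
        (suc p)))
      (span p) (ℕₚ.≤-reflexive (≡.sym p′≡p))
      (λ i i<p′ j → reflexive (≡.cong (λ f → f (toℕ j)) (mix-< (suc p) (toℕ i)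
         (ℕₚ.m<n⇒m<1+n (≡.subst (toℕ i <_) p′≡p i<p′)))))
      row-p
      off-p
      where
      p′ = fromℕ< p<n
      p′≡p : toℕ p′ ≡ p
      p′≡p = Finₚ.toℕ-fromℕ< p<n
      row-p : ∀ j → mix ρ σ p (toℕ p′) (toℕ j) ≈ mix ρ σ (suc p) (toℕ p′) (toℕ j) + (σ p ⊖ ρ p) (toℕ j)
      row-p j rewrite p′≡p | mix-≥ {ρ} {σ} p p ℕₚ.≤-refl | mix-< {ρ} {σ} (suc p) p ℕₚ.≤-refl =
        solve 2 (λ s r → s := r :+ (s :- r)) refl _ _
      off-p : ∀ i → i ≢ p′ → ∀ j → mix ρ σ p (toℕ i) (toℕ j) ≈ mix ρ σ (suc p) (toℕ i) (toℕ j)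
      off-p i i≢p′ j with ℕₚ.<-cmp (toℕ i) p
      ... | tri< i<p _ _ rewrite mix-< {ρ} {σ} p (toℕ i) i<p | mix-< {ρ} {σ} (suc p) (toℕ i)
          (ℕₚ.m<n⇒m<1+n i<p) = refl
      ... | tri≈ _ i≡p _ = ⊥-elim (i≢p′ (Finₚ.toℕ-injective (≡.trans i≡p (≡.sym p′≡p))))
      ... | tri> _ _ i>p rewrite mix-≥ {ρ} {σ} p (toℕ i) (ℕₚ.<⇒≤ i>p) | mix-≥ {ρ} {σ} (suc p)
          (toℕ i) i>p = refl
    go : ∀ p → p ≤ n → det {n} (toMatrix σ) ≈ det {n} (toMatrix (mix ρ σ p))
    go zero    _   = refl
    go (suc p) p<n = trans (go p (ℕₚ.<⇒≤ p<n)) (step p p<n)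

  -- Sequences as functionals on polynomials

  infixl 6 _⊹_·_
  _⊹_·_ : Series → Carrier → Series → Series
  (a ⊹ t · b) n = a n + t * b n

  ⊹-cong : ∀ {a a′ t t′ b b′} → a ≋ a′ → t ≈ t′ → b ≋ b′ → a ⊹ t · b ≋ a′ ⊹ t′ · b′
  ⊹-cong a≋ t≈ b≋ n = +-cong (a≋ n) (*-cong t≈ (b≋ n))

  𝟎 : Series
  𝟎 _ = 0#

  record Linear (φ : Series → Series) : Set (c ⊔ ℓ) where
    field
      cong   : ∀ {a b} → a ≋ b → φ a ≋ φ b
      homo-⊹ : ∀ a t b → φ (a ⊹ t · b) ≋ φ a ⊹ t · φ b

    homo-𝟎 : φ 𝟎 ≋ 𝟎
    homo-𝟎 n = begin
      φ 𝟎 n                       ≈⟨ solve 1 (λ x → x := (x :+ con (+ 1) :* x) :- x) refl _ ⟩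
      φ 𝟎 n + 1# * φ 𝟎 n - φ 𝟎 n  ≈⟨ +-congʳ (homo-⊹ 𝟎 1# 𝟎 n) ⟨
      φ (𝟎 ⊹ 1# · 𝟎) n - φ 𝟎 n    ≈⟨ +-congʳ (cong (λ _ → trans (+-identityˡ _) (zeroʳ _)) n) ⟩
      φ 𝟎 n - φ 𝟎 n               ≈⟨ -‿inverseʳ _ ⟩
      0#                          ∎

  -- A sequence a is the linear functional on polynomials with X ^ n ↦ a n,
  -- so that tail and X+ t are the duals of multiplication by X and X + t, and
  -- τ s is the dual of the substitution X ↦ X + s.
  X+_ : Carrier → Series → Series
  X+ t = λ a → tail a ⊹ t · a

  τ : Carrier → Series → Series
  τ s a zero    = a zero
  τ s a (suc n) = τ s ((X+ s) a) n

  tail-linear : Linear tail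
  tail-linear = record { cong = λ a≋b n → a≋b (suc n) ; homo-⊹ = λ _ _ _ _ → refl }

  X+-cong : ∀ {s t a b} → s ≈ t → a ≋ b → (X+ s) a ≋ (X+ t) b
  X+-cong s≈t a≋b = ⊹-cong (λ n → a≋b (suc n)) s≈t a≋b

  X+-linear : ∀ s → Linear (X+ s)
  X+-linear s = record
    { cong   = X+-cong refl
    ; homo-⊹ = λ a t b n → solve 6 (λ x t y s x′ y′ →
        x :+ t :* y :+ s :* (x′ :+ t :* y′) := x :+ s :* x′ :+ t :* (y :+ s :* y′)) refl _ t _ s _ _
    }

  X+-comm : ∀ s t a → (X+ s) ((X+ t) a) ≋ (X+ t) ((X+ s) a)
  X+-comm s t a n = solve 5 (λ x y z s t → z :+ t :* y :+ s :*
      (y :+ t :* x) := z :+ s :* y :+ t :* (y :+ s :* x))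
    refl _ _ _ s t

  τ-cong : ∀ {s t a b} → s ≈ t → a ≋ b → τ s a ≋ τ t b
  τ-cong s≈t a≋b zero    = a≋b zero
  τ-cong s≈t a≋b (suc n) = τ-cong s≈t (X+-cong s≈t a≋b) n

  τ-linear : ∀ s → Linear (τ s)
  τ-linear s = record { cong = τ-cong refl ; homo-⊹ = homo }
    where
    homo : ∀ a t b → τ s (a ⊹ t · b) ≋ τ s a ⊹ t · τ s b
    homo a t b zero    = refl
    homo a t b (suc n) = trans (τ-cong refl (Linear.homo-⊹ (X+-linear s) a t b) n) (homo _ t _ n)

  module τ s = Linear (τ-linear s)

  X+-τ : ∀ s t a → (X+ t) (τ s a) ≋ τ s ((X+ (t + s)) a)
  X+-τ s t a n = begin
    τ s ((X+ s) a) n + t * τ s a n  ≈⟨ τ.homo-⊹ s ((X+ s) a) t a n ⟨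
    τ s ((X+ s) a ⊹ t · a) n        ≈⟨ τ.cong s (λ k → solve 4
        (λ x y s t → y :+ s :* x :+ t :* x := y :+ (t :+ s) :* x)
                                         refl _ _ s t) n ⟩
    τ s ((X+ (t + s)) a) n          ∎

  τ-∘ : ∀ s t a → τ s (τ t a) ≋ τ (s + t) a
  τ-∘ s t a zero    = refl
  τ-∘ s t a (suc n) = trans (τ.cong s (X+-τ t s a) n) (τ-∘ s t ((X+ (s + t)) a) n)

  τ-0 : ∀ a → τ 0# a ≋ a
  τ-0 a zero    = refl
  τ-0 a (suc n) = trans (τ.cong 0# (λ k → trans (+-congˡ (zeroˡ _)) (+-identityʳ _)) n) (τ-0 (tail a) n)

  τ-inverse : ∀ s t a → s + t ≈ 0# → τ s (τ t a) ≋ a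
  τ-inverse s t a s+t≈0 n = trans (τ-∘ s t a n) (trans (τ-cong s+t≈0 (λ _ → refl) n) (τ-0 a n))

  Vanishes : ℕ → Series → Set ℓ
  Vanishes n a = ∀ j → j < n → a j ≈ 0#

  X+-vanishes : ∀ s {n a} → Vanishes (suc n) a → Vanishes n ((X+ s) a)
  X+-vanishes s van j j<n = trans (+-cong (van (suc j) (s≤s j<n)) (trans (*-congˡ (van j
      (ℕₚ.m<n⇒m<1+n j<n))) (zeroʳ s)))
                                  (+-identityˡ 0#)

  -- (X + s)ⁿ is Xⁿ plus lower powers, and `a` vanishes on those.
  τ-leading : ∀ s n {a} → Vanishes n a → τ s a n ≈ a n
  τ-leading s zero    van = refl
  τ-leading s (suc n) {a} van = begin
    τ s ((X+ s) a) n     ≈⟨ τ-leading s n (X+-vanishes s van) ⟩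
    a (suc n) + s * a n  ≈⟨ +-congˡ (trans (*-congˡ (van n ℕₚ.≤-refl)) (zeroʳ s)) ⟩
    a (suc n) + 0#       ≈⟨ +-identityʳ _ ⟩
    a (suc n)            ∎

  τ-vanishes : ∀ s n {a} → Vanishes n a → Vanishes n (τ s a)
  τ-vanishes s n van j j<n = trans (τ-leading s j (λ i i<j → van i (ℕₚ.<-trans i<j j<n))) (van j j<n)

  τ-vanishes⁻¹ : ∀ s n {a} → Vanishes n (τ s a) → Vanishes n a
  τ-vanishes⁻¹ s n {a} van j j<n = trans (sym (τ-inverse (- s) s a (-‿inverseˡ s) j)) (τ-vanishes
      (- s) n van j j<n)

  -- The first two terms of the expansion of (X + 1)ⁿ⁺¹; the others have degree below n.
  τ-subleading : ∀ n {a} → Vanishes n a → τ 1# a (suc n) ≈ a (suc n) + (1# + fromℕ n) * a n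
  τ-subleading zero    {a} van = +-congˡ (*-congʳ (sym (trans (+-congˡ fromℕ-0) (+-identityʳ 1#))))
  τ-subleading (suc n) {a} van = begin
    τ 1# ((X+ 1#) a) (suc n)
      ≈⟨ τ-subleading n (X+-vanishes 1# van) ⟩
    a (suc (suc n)) + 1# * a (suc n) + (1# + fromℕ n) * (a (suc n) + 1# * a n)
      ≈⟨ +-congˡ (*-congˡ (trans (+-congˡ (trans (*-congˡ (van n ℕₚ.≤-refl)) (zeroʳ 1#)))
          (+-identityʳ _))) ⟩
    a (suc (suc n)) + 1# * a (suc n) + (1# + fromℕ n) * a (suc n)
      ≈⟨ solve 3 (λ x y k → x :+ con (+ 1) :* y :+ (con (+ 1) :+ k) :* y := x :+ (con (+ 1) :+
          (con (+ 1) :+ k)) :* y)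
           refl _ _ (fromℕ n) ⟩
    a (suc (suc n)) + (1# + (1# + fromℕ n)) * a (suc n)
      ≈⟨ +-congˡ (*-congʳ (+-congˡ (fromℕ-suc n))) ⟨
    a (suc (suc n)) + (1# + fromℕ (suc n)) * a (suc n) ∎

  -- A functional invariant under X ↦ X + 1 kills all differences f (X + 1) - f (X). Taking f = Xⁿ⁺¹
  -- gives (n + 1) a n = 0 once the lower moments are known to vanish.
  τ-fixed⇒𝟎 : ∀ {a} → τ 1# a ≋ a → a ≋ 𝟎
  τ-fixed⇒𝟎 {a} fixed = <-rec _ (λ n rec → 1+fromℕ-cancelˡ n (begin
    (1# + fromℕ n) * a n
      ≈⟨ solve 2 (λ x y → x := (y :+ x) :- y) refl _ (a (suc n)) ⟩
    a (suc n) + (1# + fromℕ n) * a n - a (suc n)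
      ≈⟨ +-congʳ (τ-subleading n (λ j j<n → rec j<n)) ⟨
    τ 1# a (suc n) - a (suc n)
      ≈⟨ +-congʳ (fixed (suc n)) ⟩
    a (suc n) - a (suc n)
      ≈⟨ -‿inverseʳ _ ⟩
    0#
      ≈⟨ zeroʳ _ ⟨
    (1# + fromℕ n) * 0# ∎))

  -- Evaluation and derivative at a point as functionals.

  power : Carrier → Series
  power y n = y ^ n

  -- The functional f ↦ f′(y), i.e. n ↦ n y ^ (n - 1).
  δ : Carrier → Series
  δ y zero    = 0#
  δ y (suc n) = y * δ y n + y ^ n

  δ-suc : ∀ y n → δ y (suc n) ≈ fromℕ (suc n) * y ^ n
  δ-suc y zero    = trans (+-congʳ (zeroʳ y)) (trans (+-identityˡ 1#) (sym (trans
      (*-identityʳ _) fromℕ-1)))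
  δ-suc y (suc n) = begin
    y * δ y (suc n) + y * y ^ n              ≈⟨ +-congʳ (*-congˡ (δ-suc y n)) ⟩
    y * (fromℕ (suc n) * y ^ n) + y * y ^ n  ≈⟨ solve 3 (λ y k p → y :* (k :* p) :+ y :* p := (con
        (+ 1) :+ k) :* (y :* p))
                                                  refl y _ _ ⟩
    (1# + fromℕ (suc n)) * (y * y ^ n)       ≈⟨ *-congʳ (fromℕ-suc (suc n)) ⟨
    fromℕ (suc (suc n)) * (y * y ^ n)        ∎

  power-cong : ∀ {y z} → y ≈ z → power y ≋ power z
  power-cong y≈z zero    = refl
  power-cong y≈z (suc n) = *-cong y≈z (power-cong y≈z n)

  δ-cong : ∀ {y z} → y ≈ z → δ y ≋ δ z
  δ-cong y≈z zero    = refl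
  δ-cong y≈z (suc n) = +-cong (*-cong y≈z (δ-cong y≈z n)) (power-cong y≈z n)

  scale : Carrier → Series → Series
  scale t a n = t * a n

  τ-scale : ∀ s t a → τ s (scale t a) ≋ scale t (τ s a)
  τ-scale s t a n = begin
    τ s (scale t a) n     ≈⟨ τ.cong s (λ k → sym (+-identityˡ _)) n ⟩
    τ s (𝟎 ⊹ t · a) n     ≈⟨ τ.homo-⊹ s 𝟎 t a n ⟩
    τ s 𝟎 n + t * τ s a n ≈⟨ +-congʳ (τ.homo-𝟎 s n) ⟩
    0# + t * τ s a n      ≈⟨ +-identityˡ _ ⟩
    t * τ s a n           ∎

  τ-power : ∀ s y → τ s (power y) ≋ power (y + s)
  τ-power s y zero    = refl
  τ-power s y (suc n) = begin
    τ s ((X+ s) (power y)) n        ≈⟨ τ.cong s (λ k → sym (distribʳ _ y s)) n ⟩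
    τ s (scale (y + s) (power y)) n ≈⟨ τ-scale s (y + s) (power y) n ⟩
    (y + s) * τ s (power y) n       ≈⟨ *-congˡ (τ-power s y n) ⟩
    (y + s) * (y + s) ^ n           ∎

  τ-δ : ∀ s y → τ s (δ y) ≋ δ (y + s)
  τ-δ s y zero    = refl
  τ-δ s y (suc n) = begin
    τ s ((X+ s) (δ y)) n
      ≈⟨ τ.cong s (λ k → solve 4 (λ y s d p → y :* d :+ p :+ s :* d := p :+
          (y :+ s) :* d) refl y s _ _) n ⟩
    τ s (power y ⊹ (y + s) · δ y) n
      ≈⟨ τ.homo-⊹ s (power y) (y + s) (δ y) n ⟩
    τ s (power y) n + (y + s) * τ s (δ y) n
      ≈⟨ +-cong (τ-power s y n) (*-congˡ (τ-δ s y n)) ⟩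
    (y + s) ^ n + (y + s) * δ (y + s) n
      ≈⟨ +-comm _ _ ⟩
    (y + s) * δ (y + s) n + (y + s) ^ n ∎

  X-y-power : ∀ y → (X+ (- y)) (power y) ≋ 𝟎
  X-y-power y n = solve 2 (λ y p → y :* p :+ (:- y) :* p := con (+ 0)) refl y _

  X-y-δ : ∀ y → (X+ (- y)) (δ y) ≋ power y
  X-y-δ y n = solve 3 (λ y d p → y :* d :+ p :+ (:- y) :* d := p) refl y _ _

  -- Exponential generating functions and the difference equation of the Bernoulli polynomials.

  1/!-inverse : ∀ n → ι (1/ n !) * fromℕ (n !) ≈ 1#
  1/!-inverse n = 1/-inverse (n !) {{n ℕₚ.!≢0}}

  1/!-suc : ∀ n → fromℕ (suc n) * ι (1/ (suc n) !) ≈ ι (1/ n !)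
  1/!-suc n = invertible-cancelˡ (ι (1/ n !)) (fromℕ (n !)) (1/!-inverse n) (begin
    fromℕ (n !) * (fromℕ (suc n) * ι (1/ (suc n) !))
      ≈⟨ solve 3 (λ x y z → x :* (y :* z) := z :* (y :* x)) refl _ _ _ ⟩
    ι (1/ (suc n) !) * (fromℕ (suc n) * fromℕ (n !))
      ≈⟨ *-congˡ (fromℕ-* (suc n) (n !)) ⟨
    ι (1/ (suc n) !) * fromℕ (suc n !)
      ≈⟨ 1/!-inverse (suc n) ⟩
    1#
      ≈⟨ 1/!-inverse n ⟨
    ι (1/ n !) * fromℕ (n !)
      ≈⟨ *-comm _ _ ⟩
    fromℕ (n !) * ι (1/ n !) ∎)

  ⊛-cong : ∀ {f g h k} → f ≋ g → h ≋ k → f ⊛ h ≋ g ⊛ k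
  ⊛-cong f≋g h≋k n = sum-cong-≋ {suc n} (λ i → *-cong (f≋g (toℕ i)) (h≋k (n ℕ.∸ toℕ i)))

  ⊛-homo-⊹ˡ : ∀ f t g h → (f ⊹ t · g) ⊛ h ≋ f ⊛ h ⊹ t · (g ⊛ h)
  ⊛-homo-⊹ˡ f t g h n = trans
    (sum-cong-≋ {suc n} (λ i → solve 4 (λ x t y z → (x :+ t :* y) :* z := x :* z :+ t :* (y :* z)) refl
      (f (toℕ i)) t (g (toℕ i)) (h (n ℕ.∸ toℕ i))))
    (sum-linear {suc n} t (λ i → f (toℕ i) * h (n ℕ.∸ toℕ i)) (λ i → g (toℕ i) * h (n ℕ.∸ toℕ i)))

  ⊛-homo-⊹ʳ : ∀ h f t g → h ⊛ (f ⊹ t · g) ≋ h ⊛ f ⊹ t · (h ⊛ g)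
  ⊛-homo-⊹ʳ h f t g n = trans
    (sum-cong-≋ {suc n} (λ i → solve 4 (λ z x t y → z :* (x :+ t :* y) := z :* x :+ t :* (z :* y)) refl
      (h (toℕ i)) (f (n ℕ.∸ toℕ i)) t (g (n ℕ.∸ toℕ i))))
    (sum-linear {suc n} t (λ i → h (toℕ i) * f (n ℕ.∸ toℕ i)) (λ i → h (toℕ i) * g (n ℕ.∸ toℕ i)))

  ⊛-one : ∀ f → f ⊛ one ≋ f
  ⊛-one f zero    = trans (+-identityʳ _) (*-identityʳ _)
  ⊛-one f (suc n) = trans (+-cong (zeroʳ _) (⊛-one (tail f) n)) (+-identityˡ _)

  derivative : Series → Series
  derivative f n = fromℕ (suc n) * f (suc n)

  -- The Leibniz rule in the case g′ = g, which suffices for g = exp (t). The induction passes to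
  -- `tail f`; `tail-derivative` is the derivative of f = f₀ + t · tail f, read coefficientwise.
  derivative-⊛ : ∀ f g → derivative g ≋ g → derivative (f ⊛ g) ≋ derivative f ⊛ g ⊹ 1# · (f ⊛ g)
  derivative-⊛ f g g′≋g zero = begin
    fromℕ 1 * (f 0 * g 1 + (f 1 * g 0 + 0#))
      ≈⟨ solve 5 (λ k x y z w → k :* (x :* y :+ (z :* w :+ con (+ 0))) := k :* z :* w :+ x :* (k :* y))
           refl (fromℕ 1) (f 0) (g 1) (f 1) (g 0) ⟩
    fromℕ 1 * f 1 * g 0 + f 0 * (fromℕ 1 * g 1)
      ≈⟨ +-congˡ (*-congˡ (g′≋g 0)) ⟩
    fromℕ 1 * f 1 * g 0 + f 0 * g 0
      ≈⟨ solve 2 (λ x y → x :+ y := x :+ con (+ 0) :+ con (+ 1) :* (y :+ con (+ 0))) refl _ _ ⟩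
    fromℕ 1 * f 1 * g 0 + 0# + 1# * (f 0 * g 0 + 0#) ∎
  derivative-⊛ f g g′≋g (suc n) = begin
    fromℕ (suc (suc n)) * (f 0 * g (suc (suc n)) + (tail f ⊛ g) (suc n))
      ≈⟨ solve 4 (λ k x y z → k :* (x :* y :+ z) := x :* (k :* y) :+ k :* z) refl _ _ _ _ ⟩
    f 0 * (fromℕ (suc (suc n)) * g (suc (suc n))) + fromℕ (suc (suc n)) * (tail f ⊛ g) (suc n)
      ≈⟨ +-cong (*-congˡ (g′≋g (suc n))) (trans (*-congʳ (fromℕ-suc (suc n))) (trans
          (distribʳ _ 1# _) (+-congˡ (derivative-⊛ (tail f) g g′≋g n)))) ⟩
    f 0 * g (suc n) + (1# * (f 1 * g (suc n) + (tail (tail f) ⊛ g) n) + ((derivative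
        (tail f) ⊛ g) n + 1# * (tail f ⊛ g) n))
      ≈⟨ solve 6 (λ x y z u v w → x :* z :+ (con (+ 1) :* (y :* z :+ u) :+ (v :+ con (+ 1) :* w))
            := con (+ 1) :* y :* z :+ (v :+ con (+ 1) :* u) :+ con (+ 1) :* (x :* z :+ w))
          refl (f 0) (f 1) (g (suc n)) _ _ _ ⟩
    1# * f 1 * g (suc n) + ((derivative (tail f) ⊛ g) n + 1# * (tail (tail f) ⊛ g) n) + 1# *
        (f ⊛ g) (suc n)
      ≈⟨ +-congʳ (+-cong (*-congʳ (*-congʳ fromℕ-1)) (trans (⊛-cong {h = g} tail-derivative
          (λ _ → refl) n) (⊛-homo-⊹ˡ (derivative (tail f)) 1# (tail (tail f)) g n))) ⟨
    fromℕ 1 * f 1 * g (suc n) + (tail (derivative f) ⊛ g) n + 1# * (f ⊛ g) (suc n) ∎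
    where
    tail-derivative : tail (derivative f) ≋ derivative (tail f) ⊹ 1# · tail (tail f)
    tail-derivative k = trans (*-congʳ (fromℕ-suc (suc k))) (trans (distribʳ _ 1# _) (+-comm _ _))

  derivative-exp : derivative (exp 1#) ≋ exp 1#
  derivative-exp n = begin
    fromℕ (suc n) * (ι (1/ (suc n) !) * (1# * 1# ^ n))  ≈⟨ *-assoc _ _ _ ⟨
    fromℕ (suc n) * ι (1/ (suc n) !) * (1# * 1# ^ n)    ≈⟨ *-cong (1/!-suc n) (*-identityˡ _) ⟩
    ι (1/ n !) * 1# ^ n                                 ∎

  derivative-egf : ∀ a → derivative (egf a) ≋ egf (tail a)
  derivative-egf a n = trans (sym (*-assoc _ _ _)) (*-congʳ (1/!-suc n))

  -- Multiplication by exp (t) is binomial convolution. Differentiating avoids binomial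
  -- coefficients: both sides take `a` at n + 1 to the sum of their values for `tail a` and `a` at
  -- n.
  egf-τ : ∀ a n → fromℕ (n !) * (egf a ⊛ exp 1#) n ≈ τ 1# a n
  egf-τ a zero = begin
    fromℕ (0 !) * (ι (1/ 0 !) * a 0 * (ι (1/ 0 !) * 1#) + 0#)
      ≈⟨ solve 3 (λ k u x → k :* (u :* x :* (u :* con (+ 1)) :+ con (+ 0)) := u :* k :* (u :* x))
           refl _ _ _ ⟩
    ι (1/ 0 !) * fromℕ (0 !) * (ι (1/ 0 !) * a 0)
      ≈⟨ *-cong (1/!-inverse 0) (*-congʳ ι.1#-homo) ⟩
    1# * (1# * a 0)
      ≈⟨ trans (*-identityˡ _) (*-identityˡ _) ⟩
    a 0 ∎
  egf-τ a (suc n) = begin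
    fromℕ (suc n !) * (egf a ⊛ exp 1#) (suc n)
      ≈⟨ *-congʳ (fromℕ-* (suc n) (n !)) ⟩
    fromℕ (suc n) * fromℕ (n !) * (egf a ⊛ exp 1#) (suc n)
      ≈⟨ solve 3 (λ x y z → x :* y :* z := y :* (x :* z)) refl _ _ _ ⟩
    fromℕ (n !) * derivative (egf a ⊛ exp 1#) n
      ≈⟨ *-congˡ (derivative-⊛ (egf a) (exp 1#) derivative-exp n) ⟩
    fromℕ (n !) * ((derivative (egf a) ⊛ exp 1#) n + 1# * (egf a ⊛ exp 1#) n)
      ≈⟨ *-congˡ (+-congʳ (⊛-cong {h = exp 1#} (derivative-egf a) (λ _ → refl) n)) ⟩
    fromℕ (n !) * ((egf (tail a) ⊛ exp 1#) n + 1# * (egf a ⊛ exp 1#) n)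
      ≈⟨ solve 3 (λ k x y → k :* (x :+ con (+ 1) :* y) := k :* x :+ con (+ 1) :* (k :* y)) refl _ _ _ ⟩
    fromℕ (n !) * (egf (tail a) ⊛ exp 1#) n + 1# * (fromℕ (n !) * (egf a ⊛ exp 1#) n)
      ≈⟨ +-cong (egf-τ (tail a) n) (*-congˡ (egf-τ a n)) ⟩
    τ 1# (tail a) n + 1# * τ 1# a n
      ≈⟨ τ.homo-⊹ 1# (tail a) 1# a n ⟨
    τ 1# ((X+ 1#) a) n ∎

  -- `B-egf` read as egf · exp (t) = egf + t exp (y t), where t exp (y t) is the exponential
  -- generating function of `δ y`.
  τ-B : ∀ y → τ 1# (λ k → B k y) ≋ (λ k → B k y) ⊹ 1# · δ y
  τ-B y n = begin
    τ 1# b n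
      ≈⟨ egf-τ b n ⟨
    fromℕ (n !) * (egf b ⊛ exp 1#) n
      ≈⟨ *-congˡ (begin
        (egf b ⊛ exp 1#) n
          ≈⟨ solve 2 (λ x y → x := (x :+ :- con (+ 1) :* y) :+ y) refl _ _ ⟩
        (egf b ⊛ exp 1#) n + - 1# * (egf b ⊛ one) n + (egf b ⊛ one) n
          ≈⟨ +-cong (sym (⊛-homo-⊹ʳ (egf b) (exp 1#) (- 1#) one n)) (⊛-one (egf b) n) ⟩
        (egf b ⊛ (exp 1# ⊹ - 1# · one)) n + egf b n
          ≈⟨ +-congʳ (⊛-cong {f = egf b} (λ _ → refl) (λ k → +-congˡ {exp 1# k} (-1*x≈-x (one k))) n) ⟩
        (egf b ⊛ (exp 1# ⊖ one)) n + egf b n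
          ≈⟨ +-congʳ (B-egf y n) ⟩
        (t· exp y) n + egf b n ∎) ⟩
    fromℕ (n !) * ((t· exp y) n + ι (1/ n !) * b n)
      ≈⟨ solve 4 (λ k e u b → k :* (e :+ u :* b) := u :* k :* b :+ con (+ 1) :* (k :* e)) refl _ _ _ _ ⟩
    ι (1/ n !) * fromℕ (n !) * b n + 1# * (fromℕ (n !) * (t· exp y) n)
      ≈⟨ +-cong (trans (*-congʳ (1/!-inverse n)) (*-identityˡ _)) (*-congˡ (t·exp n)) ⟩
    b n + 1# * δ y n ∎
    where
    b : Series
    b k = B k y
    t·exp : ∀ n → fromℕ (n !) * (t· exp y) n ≈ δ y n
    t·exp zero    = zeroʳ _
    t·exp (suc n) = begin
      fromℕ (suc n !) * (ι (1/ n !) * y ^ n)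
        ≈⟨ *-congʳ (fromℕ-* (suc n) (n !)) ⟩
      fromℕ (suc n) * fromℕ (n !) * (ι (1/ n !) * y ^ n)
        ≈⟨ solve 4 (λ k f u p → k :* f :* (u :* p) := u :* f :* (k :* p)) refl _ _ _ _ ⟩
      ι (1/ n !) * fromℕ (n !) * (fromℕ (suc n) * y ^ n)
        ≈⟨ trans (*-congʳ (1/!-inverse n)) (*-identityˡ _) ⟩
      fromℕ (suc n) * y ^ n
        ≈⟨ δ-suc y n ⟨
      δ y (suc n) ∎

  -- a (f (X + 1) - f) = f′(y) - f′(z) for all polynomials f.
  Telescopes : Series → Carrier → Carrier → Set ℓ
  Telescopes a y z = τ 1# a ≋ a ⊹ 1# · δ y ⊹ - 1# · δ z

  B-difference-telescopes : ∀ y z → Telescopes (λ k → B k y - B k z) y z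
  B-difference-telescopes y z n = begin
    τ 1# (λ k → B k y - B k z) n
      ≈⟨ τ.cong 1# (λ k → +-congˡ (sym (-1*x≈-x _))) n ⟩
    τ 1# ((λ k → B k y) ⊹ - 1# · (λ k → B k z)) n
      ≈⟨ τ.homo-⊹ 1# _ (- 1#) _ n ⟩
    τ 1# (λ k → B k y) n + - 1# * τ 1# (λ k → B k z) n
      ≈⟨ +-cong (τ-B y n) (*-congˡ (τ-B z n)) ⟩
    B n y + 1# * δ y n + - 1# * (B n z + 1# * δ z n)
      ≈⟨ solve 4 (λ b d b′ d′ → b :+ con (+ 1) :* d :+ :- con (+ 1) :* (b′ :+ con (+ 1) :* d′)
            := b :- b′ :+ con (+ 1) :* d :+ :- con (+ 1) :* d′) refl _ _ _ _ ⟩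
    B n y - B n z + 1# * δ y n + - 1# * δ z n ∎

  Telescopes-τ : ∀ s {a y z} → Telescopes a y z → Telescopes (τ s a) (y + s) (z + s)
  Telescopes-τ s {a} {y} {z} tel n = begin
    τ 1# (τ s a) n
      ≈⟨ τ-∘ 1# s a n ⟩
    τ (1# + s) a n
      ≈⟨ τ-cong (+-comm 1# s) (λ _ → refl) n ⟩
    τ (s + 1#) a n
      ≈⟨ τ-∘ s 1# a n ⟨
    τ s (τ 1# a) n
      ≈⟨ τ.cong s tel n ⟩
    τ s (a ⊹ 1# · δ y ⊹ - 1# · δ z) n
      ≈⟨ trans (τ.homo-⊹ s _ (- 1#) _ n) (+-congʳ (τ.homo-⊹ s a 1# _ n)) ⟩
    τ s a n + 1# * τ s (δ y) n + - 1# * τ s (δ z) n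
      ≈⟨ +-cong (+-congˡ (*-congˡ (τ-δ s y n))) (*-congˡ (τ-δ s z n)) ⟩
    τ s a n + 1# * δ (y + s) n + - 1# * δ (z + s) n ∎

  Telescopes-cong : ∀ {a y z y′ z′} → y ≈ y′ → z ≈ z′ → Telescopes a y z → Telescopes a y′ z′
  Telescopes-cong y≈ z≈ tel n = trans (tel n) (+-cong (+-congˡ (*-congˡ (δ-cong y≈ n))) (*-congˡ
      (δ-cong z≈ n)))

  -- The reflection X ↦ -X and the vanishing of even moments.

  sign : ℕ → Carrier
  sign zero    = 1#
  sign (suc n) = - sign n

  -- The dual of the substitution X ↦ - X.
  alternate : Series → Series
  alternate a n = sign n * a n

  alternate-τ : ∀ s a → τ s (alternate a) ≋ alternate (τ (- s) a)
  alternate-τ s a zero    = refl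
  alternate-τ s a (suc n) = begin
    τ s ((X+ s) (alternate a)) n
      ≈⟨ τ.cong s (λ k → solve 4 (λ e x y s → (:- e) :* x :+ s :* (e :* y) := :- con (+ 1) :*
          (e :* (x :+ (:- s) :* y)))
           refl (sign k) _ _ s) n ⟩
    τ s (scale (- 1#) (alternate ((X+ (- s)) a))) n
      ≈⟨ τ-scale s (- 1#) _ n ⟩
    - 1# * τ s (alternate ((X+ (- s)) a)) n
      ≈⟨ *-congˡ (alternate-τ s ((X+ (- s)) a) n) ⟩
    - 1# * (sign n * τ (- s) ((X+ (- s)) a) n)
      ≈⟨ solve 2 (λ e x → :- con (+ 1) :* (e :* x) := (:- e) :* x) refl _ _ ⟩
    - sign n * τ (- s) ((X+ (- s)) a) n ∎

  alternate-power : ∀ y → alternate (power y) ≋ power (- y)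
  alternate-power y zero    = *-identityˡ 1#
  alternate-power y (suc n) = trans (solve 3 (λ e y p → (:- e) :* (y :* p) := (:- y) :*
      (e :* p)) refl (sign n) y _)
                                    (*-congˡ (alternate-power y n))

  alternate-δ : ∀ y n → sign n * δ y n ≈ - δ (- y) n
  alternate-δ y zero    = trans (zeroʳ _) (sym -0#≈0#)
  alternate-δ y (suc n) = begin
    - sign n * (y * δ y n + y ^ n)
      ≈⟨ solve 4 (λ e y d p → (:- e) :* (y :* d :+ p) := (:- y) :* (e :* d) :- e :* p) refl _ y _ _ ⟩
    - y * (sign n * δ y n) - sign n * y ^ n
      ≈⟨ +-cong (*-congˡ (alternate-δ y n)) (-‿cong (alternate-power y n)) ⟩
    - y * (- δ (- y) n) - (- y) ^ n
      ≈⟨ solve 3 (λ y d p → y :* (:- d) :- p := :- (y :* d :+ p)) refl (- y) _ _ ⟩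
    - (- y * δ (- y) n + (- y) ^ n) ∎

  sign-double : ∀ n → sign (double n) ≈ 1#
  sign-double zero    = refl
  sign-double (suc n) = trans (-‿involutive _) (sign-double n)

  module Centred (α β : Carrier) (α+β≈1 : α + β ≈ 1#) (a : Series) (tel : Telescopes a β α) where

    β-1≈-α : β + - 1# ≈ - α
    β-1≈-α = trans (+-congˡ (-‿cong (sym α+β≈1))) (solve 2 (λ α β → β :+ :- (α :+ β) := :- α) refl α β)

    α-1≈-β : α + - 1# ≈ - β
    α-1≈-β = trans (+-congˡ (-‿cong (sym α+β≈1))) (solve 2 (λ α β → α :+ :- (α :+ β) := :- β) refl α β)

    τ-1-a : τ (- 1#) a ≋ a ⊹ 1# · δ (- β) ⊹ - 1# · δ (- α)
    τ-1-a n = begin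
      τ (- 1#) a n
        ≈⟨ solve 3 (λ x y z → x := (x :+ con (+ 1) :* y :+ :- con (+ 1) :* z) :+ con
            (+ 1) :* z :+ :- con (+ 1) :* y) refl _ _ _ ⟩
      τ (- 1#) a n + 1# * δ (- α) n + - 1# * δ (- β) n + 1# * δ (- β) n + - 1# * δ (- α) n
        ≈⟨ +-congʳ (+-congʳ (trans (sym (Telescopes-cong β-1≈-α α-1≈-β (Telescopes-τ (- 1#) tel) n))
             (τ-inverse 1# (- 1#) a (-‿inverseʳ 1#) n))) ⟩
      a n + 1# * δ (- β) n + - 1# * δ (- α) n ∎

    -- The symmetry of the Bernoulli polynomials under x ↦ 1 - x in functional form. Reflection
    -- turns the difference equation into its backward version; as β - 1 = -α and α - 1 = -β, the
    -- inhomogeneous terms for `alternate a` are opposite to those for `a`, so the sum is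
    -- translation invariant.
    a+alternate-a≋𝟎 : a ⊹ 1# · alternate a ≋ 𝟎
    a+alternate-a≋𝟎 = τ-fixed⇒𝟎 (λ n → begin
      τ 1# (a ⊹ 1# · alternate a) n
        ≈⟨ τ.homo-⊹ 1# a 1# (alternate a) n ⟩
      τ 1# a n + 1# * τ 1# (alternate a) n
        ≈⟨ +-cong (tel n) (*-congˡ (trans (alternate-τ 1# a n) (*-congˡ (τ-1-a n)))) ⟩
      a n + 1# * δ β n + - 1# * δ α n + 1# * (sign n * (a n + 1# * δ (- β) n + - 1# * δ (- α) n))
        ≈⟨ solve 6 (λ x u v e w z → x :+ con (+ 1) :* u :+ :- con (+ 1) :* v :+ con (+ 1) :* (e :*
            (x :+ con (+ 1) :* w :+ :- con (+ 1) :* z))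
            := x :+ con (+ 1) :* (e :* x) :+ (u :+ e :* w) :- (v :+ e :* z)) refl _ _ _ (sign n) _ _ ⟩
      a n + 1# * (sign n * a n) + (δ β n + sign n * δ (- β) n) - (δ α n + sign n * δ (- α) n)
        ≈⟨ +-cong (+-congˡ (cancel β n)) (-‿cong (cancel α n)) ⟩
      a n + 1# * (sign n * a n) + 0# - 0#
        ≈⟨ solve 1 (λ x → x :+ con (+ 0) :- con (+ 0) := x) refl _ ⟩
      a n + 1# * (sign n * a n) ∎)
      where
      cancel : ∀ y n → δ y n + sign n * δ (- y) n ≈ 0#
      cancel y n = trans (+-congˡ (trans (alternate-δ (- y) n) (-‿cong (δ-cong
          (-‿involutive y) n)))) (-‿inverseʳ _)

    even-vanishes : ∀ n → a (double n) ≈ 0#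
    even-vanishes n = x≈-x⇒x≈0 (begin
      a (double n)
        ≈⟨ solve 2 (λ x y → x := x :+ con (+ 1) :* y :- y) refl _ _ ⟩
      a (double n) + 1# * alternate a (double n) - alternate a (double n)
        ≈⟨ +-cong (a+alternate-a≋𝟎 (double n)) (-‿cong (trans (*-congʳ (sign-double n))
            (*-identityˡ _))) ⟩
      0# - a (double n)
        ≈⟨ +-identityˡ _ ⟩
      - a (double n) ∎)

    -- The difference equation for f = X², where 2 a₁ + a₀ = 2 (β - α) and a₀ = 0.
    a₁≈β-α : a 1 ≈ β - α
    a₁≈β-α = 1+fromℕ-cancelˡ 1 (trans (*-congʳ (+-congˡ fromℕ-1)) (trans (begin
      (1# + 1#) * a 1
        ≈⟨ solve 3 (λ x y z → (con (+ 1) :+ con (+ 1)) :* y := (z :+ con (+ 1) :* y :+ con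
            (+ 1) :* (y :+ con (+ 1) :* x)) :- z :- x)
             refl (a 0) _ (a 2) ⟩
      τ 1# a 2 - a 2 - a 0
        ≈⟨ +-cong (+-congʳ (tel 2)) (-‿cong (even-vanishes 0)) ⟩
      a 2 + 1# * δ β 2 + - 1# * δ α 2 - a 2 - 0#
        ≈⟨ solve 3 (λ z α β → z :+ con (+ 1) :* d β :+ :- con (+ 1) :* d α :- z :- con (+ 0) :=
            (con (+ 1) :+ con (+ 1)) :* (β :- α))
             refl (a 2) α β ⟩
      (1# + 1#) * (β - α) ∎) (*-congʳ (+-congˡ (sym fromℕ-1)))))
      where
      d = λ y → y :* (y :* con (+ 0) :+ con (+ 1)) :+ y :* con (+ 1)

  -- Operators on sequences and the products vᵢ, uⱼ

  -- Models multiplication by a fixed polynomial through the only properties that are needed of it.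
  record Equivariant (φ : Series → Series) : Set (c ⊔ ℓ) where
    field
      linear : Linear φ
      comm   : ∀ t a → φ ((X+ t) a) ≋ (X+ t) (φ a)
    open Linear linear public

  X+-equivariant : ∀ s → Equivariant (X+ s)
  X+-equivariant s = record { linear = X+-linear s ; comm = λ t a → X+-comm s t a }

  ∘-linear : ∀ {φ ψ} → Linear φ → Linear ψ → Linear (φ ∘ ψ)
  ∘-linear φ ψ = record
    { cong   = λ a≋b → φ.cong (ψ.cong a≋b)
    ; homo-⊹ = λ a t b n → trans (φ.cong (ψ.homo-⊹ a t b) n) (φ.homo-⊹ _ t _ n)
    }
    where module φ = Linear φ
          module ψ = Linear ψ

  infixr 9 _∘ᵉ_
  _∘ᵉ_ : ∀ {φ ψ} → Equivariant φ → Equivariant ψ → Equivariant (φ ∘ ψ)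
  φ ∘ᵉ ψ = record
    { linear = ∘-linear φ.linear ψ.linear
    ; comm   = λ t a n → trans (φ.cong (ψ.comm t a) n) (φ.comm t _ n)
    }
    where module φ = Equivariant φ
          module ψ = Equivariant ψ

  -- newton X ν i is the operator ∏_{l < i} (X - ν l).
  newton : (Series → Series) → (ℕ → Carrier) → ℕ → Series → Series
  newton X ν zero    a = a
  newton X ν (suc i) a = X (newton X ν i a) ⊹ - ν i · newton X ν i a

  newton-linear : ∀ {X ν} → Linear X → ∀ i → Linear (newton X ν i)
  newton-linear X zero = record { cong = λ a≋b → a≋b ; homo-⊹ = λ _ _ _ _ → refl }
  newton-linear {ν = ν} X (suc i) = record
    { cong   = λ a≋b → ⊹-cong (X.cong (N.cong a≋b)) refl (N.cong a≋b)
    ; homo-⊹ = λ a t b n → trans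
        (+-cong (trans (X.cong (N.homo-⊹ a t b) n) (X.homo-⊹ _ t _ n)) (*-congˡ (N.homo-⊹ a t b n)))
        (solve 6 (λ x y t u v w → x :+ t :* y :+ u :* (v :+ t :* w) := x :+ u :* v :+ t :*
            (y :+ u :* w))
          refl _ _ t (- ν i) _ _)
    }
    where module X = Linear X
          module N = Linear (newton-linear {ν = ν} X i)

  module _ {φ X Y : Series → Series} (φ-linear : Linear φ) (Y-linear : Linear Y)
           (φX≋Yφ : ∀ a → φ (X a) ≋ Y (φ a)) where
    private
      module φ = Linear φ-linear
      module Y = Linear Y-linear

    -- Transports a product from one variable to another: from X² acting on a sequence to X acting
    -- on its odd part, and, with `X` = `Y` = `tail`, past another Newton product. `elim-natural`
    -- below extends this to the eliminated polynomials.
    newton-natural : ∀ ν i a → φ (newton X ν i a) ≋ newton Y ν i (φ a)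
    newton-natural ν zero    a n = refl
    newton-natural ν (suc i) a n = begin
      φ (X (newton X ν i a) ⊹ - ν i · newton X ν i a) n
        ≈⟨ φ.homo-⊹ _ (- ν i) _ n ⟩
      φ (X (newton X ν i a)) n + - ν i * φ (newton X ν i a) n
        ≈⟨ +-cong (trans (φX≋Yφ _ n) (Y.cong (newton-natural ν i a) n)) (*-congˡ
            (newton-natural ν i a n)) ⟩
      Y (newton Y ν i (φ a)) n + - ν i * newton Y ν i (φ a) n ∎

  newton-tail-leading : ∀ ν i k {a} → Vanishes (i ℕ.+ k) a → newton tail ν i a k ≈ a (i ℕ.+ k)
  newton-tail-leading ν zero    k van = refl
  newton-tail-leading ν (suc i) k {a} van = begin
    newton tail ν i a (suc k) + - ν i * newton tail ν i a k
      ≈⟨ +-cong (newton-tail-leading ν i (suc k) (≡.subst (λ n → Vanishes n a) (≡.sym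
          (ℕₚ.+-suc i k)) van))
                (*-congˡ (newton-tail-leading ν i k (λ j j<n → van j (ℕₚ.m<n⇒m<1+n j<n)))) ⟩
    a (i ℕ.+ suc k) + - ν i * a (i ℕ.+ k)
      ≈⟨ +-cong (reflexive (≡.cong a (ℕₚ.+-suc i k))) (trans (*-congˡ (van (i ℕ.+ k) ℕₚ.≤-refl))
          (zeroʳ _)) ⟩
    a (suc (i ℕ.+ k)) + 0#
      ≈⟨ +-identityʳ _ ⟩
    a (suc (i ℕ.+ k)) ∎

  newton-tail-leading₀ : ∀ ν n {a} → Vanishes n a → newton tail ν n a 0 ≈ a n
  newton-tail-leading₀ ν n {a} van = trans
    (newton-tail-leading ν n 0 (≡.subst (λ n → Vanishes n a) (≡.sym (ℕₚ.+-identityʳ n)) van))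
    (reflexive (≡.cong a (ℕₚ.+-identityʳ n)))

  -- The Newton products are monic, one in each degree, so testing on the first n of them is as good
  -- as testing on 1, ..., Xⁿ⁻¹.
  newton-tail-vanishes : ∀ ν n {a} → (∀ j → j < n → newton tail ν j a 0 ≈ 0#) → Vanishes n a
  newton-tail-vanishes ν n {a} N≈0 = <-rec _ (λ j rec j<n →
    trans (sym (newton-tail-leading₀ ν j (λ i i<j → rec i<j (ℕₚ.<-trans i<j j<n)))) (N≈0 j j<n))

  -- Products in X², parity, and the reflection identity.

  E² : Series → Series
  E² = tail ∘ tail

  E²-linear : Linear E²
  E²-linear = ∘-linear tail-linear tail-linear

  odd even : Series → Series
  odd  a n = a (suc (double n))
  even a n = a (double n)

  odd-linear : Linear odd
  odd-linear = record { cong = λ a≋b n → a≋b (suc (double n)) ; homo-⊹ = λ _ _ _ _ → refl }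

  even-linear : Linear even
  even-linear = record { cong = λ a≋b n → a≋b (double n) ; homo-⊹ = λ _ _ _ _ → refl }

  nodes : Carrier → ℕ → Carrier
  nodes α i = (α + fromℕ i) * (α + fromℕ i)

  E²-u² : ∀ u a → E² a ⊹ - (u * u) · a ≋ (X+ u) ((X+ (- u)) a)
  E²-u² u a n = solve 4 (λ x y z u → z :+ (:- (u :* u)) :* x := z :+ (:- u) :* y :+ u :* (y :+
      (:- u) :* x)) refl _ _ _ u

  τ-X+ : ∀ t a → τ 1# ((X+ t) a) ≋ (X+ (t - 1#)) (τ 1# a)
  τ-X+ t a n = trans (τ.cong 1# (X+-cong (solve 1 (λ t → t := t :- con (+ 1) :+ con (+ 1)) refl t)
      (λ _ → refl)) n)
                     (sym (X+-τ 1# (t - 1#) a n))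

  -- At index 0: the functional y does not distinguish (X + u) φ from (X - u) ψ.
  Reflects : (φ ψ : Series → Series) → Carrier → Series → Set ℓ
  Reflects φ ψ u y = τ 1# ((X+ u) (φ y)) ≋ (X+ (- u)) (ψ y)

  Reflects-cong : ∀ {φ ψ u u′ y} → u ≈ u′ → Reflects φ ψ u y → Reflects φ ψ u′ y
  Reflects-cong {φ} {ψ} {y = y} u≈ r n =
    trans (τ.cong 1# (X+-cong {a = φ y} (sym u≈) (λ _ → refl)) n)
      (trans (r n) (X+-cong {a = ψ y} (-‿cong u≈) (λ _ → refl) n))

  -- Of X² - u² = (X + u)(X - u), the factor X + u serves the hypothesis. The remaining X - u and X
  -- + u + 1 leave the substitution X ↦ X + 1 as X - (u + 1) and X + u, and this X + u recombines
  -- with the X - u supplied by the hypothesis.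
  Reflects-step : ∀ {φ ψ} → Equivariant φ → Equivariant ψ → ∀ u y → Reflects φ ψ u y →
                  Reflects φ ψ (u + 1#) (E² y ⊹ - (u * u) · y)
  Reflects-step {φ} {ψ} φ-eq ψ-eq u y refl-y n = begin
    τ 1# ((X+ (u + 1#)) (φ (E² y ⊹ - (u * u) · y))) n
      ≈⟨ τ.cong 1# (X+-cong refl (λ k → trans (φ.cong (E²-u² u y) k)
           (trans (φ.comm u _ k) (trans (X+-cong refl (φ.comm (- u) y) k) (X+-comm u (- u)
               (φ y) k))))) n ⟩
    τ 1# ((X+ (u + 1#)) ((X+ (- u)) ((X+ u) (φ y)))) n
      ≈⟨ τ-X+ (u + 1#) _ n ⟩
    (X+ (u + 1# - 1#)) (τ 1# ((X+ (- u)) ((X+ u) (φ y)))) n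
      ≈⟨ X+-cong (solve 1 (λ u → u :+ con (+ 1) :- con (+ 1) := u) refl u) (τ-X+ (- u) _) n ⟩
    (X+ u) ((X+ (- u - 1#)) (τ 1# ((X+ u) (φ y)))) n
      ≈⟨ X+-cong refl (X+-cong (solve 1 (λ u → :- u :- con (+ 1) := :- (u :+ con
          (+ 1))) refl u) refl-y) n ⟩
    (X+ u) ((X+ (- (u + 1#))) ((X+ (- u)) (ψ y))) n
      ≈⟨ X+-comm u (- (u + 1#)) ((X+ (- u)) (ψ y)) n ⟩
    (X+ (- (u + 1#))) ((X+ u) ((X+ (- u)) (ψ y))) n
      ≈⟨ X+-cong refl (λ k → trans (ψ.cong (E²-u² u y) k) (trans (ψ.comm u _ k) (X+-cong refl
          (ψ.comm (- u) y) k))) n ⟨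
    (X+ (- (u + 1#))) (ψ (E² y ⊹ - (u * u) · y)) n ∎
    where module φ = Equivariant φ-eq
          module ψ = Equivariant ψ-eq

  Reflects-newton : ∀ {φ ψ} → Equivariant φ → Equivariant ψ → ∀ α y → Reflects φ ψ α y →
                    ∀ i → Reflects φ ψ (α + fromℕ i) (newton E² (nodes α) i y)
  Reflects-newton {φ} {ψ} _ _ α y r zero = Reflects-cong {φ} {ψ} (sym (trans (+-congˡ fromℕ-0)
      (+-identityʳ α))) r
  Reflects-newton {φ} {ψ} φ-eq ψ-eq α y r (suc i) = Reflects-cong {φ} {ψ}
    (trans (+-assoc _ _ _) (+-congˡ (trans (+-comm _ _) (sym (fromℕ-suc i)))))
    (Reflects-step φ-eq ψ-eq (α + fromℕ i) (newton E² (nodes α) i y)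
        (Reflects-newton φ-eq ψ-eq α y r i))

  -- At index 0 the functional agrees on f (X) and f (-X) for the quartic f = (X + u)(X + v)(X +
  -- α)(X + β), so e₁ y₃ + e₃ y₁ = 0 with eᵢ the elementary symmetric functions of u, v, α, β. Since
  -- u is among them, e₃ + u² e₁ = (u + α)(u + β)(u + v).
  Reflects-value : ∀ u v α β y →
    Reflects ((X+ v) ∘ (X+ α) ∘ (X+ β)) ((X+ (- v)) ∘ (X+ (- α)) ∘ (X+ (- β))) u y →
    (u + v + α + β) * (E² y ⊹ - (u * u) · y) 1 ≈ - ((u + α) * (u + β) * (u + v)) * y 1
  Reflects-value u v α β y r = 1+fromℕ-cancelˡ 1 (trans (*-congʳ (+-congˡ fromℕ-1)) (trans (begin
    (1# + 1#) * ((u + v + α + β) * (E² y ⊹ - (u * u) · y) 1)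
      ≈⟨ solve 9 (λ y₀ y₁ y₂ y₃ y₄ u v α β →
           (con (+ 1) :+ con (+ 1)) :* ((u :+ v :+ α :+ β) :* (y₃ :+ (:- (u :* u)) :* y₁))
           := (four y₀ y₁ y₂ y₃ y₄ u v α β :- four y₀ y₁ y₂ y₃ y₄ (:- u) (:- v) (:- α) (:- β))
              :+ (con (+ 1) :+ con (+ 1)) :* ((:- ((u :+ α) :* (u :+ β) :* (u :+ v))) :* y₁))
         refl (y 0) (y 1) (y 2) (y 3) (y 4) u v α β ⟩
    (X+ u) ((X+ v) ((X+ α) ((X+ β) y))) 0 - (X+ (- u)) ((X+ (- v)) ((X+ (- α)) ((X+
        (- β)) y))) 0 + (1# + 1#) * (- ((u + α) * (u + β) * (u + v)) * y 1)
      ≈⟨ +-congʳ (trans (+-congʳ (r 0)) (-‿inverseʳ _)) ⟩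
    0# + (1# + 1#) * (- ((u + α) * (u + β) * (u + v)) * y 1)
      ≈⟨ +-identityˡ _ ⟩
    (1# + 1#) * (- ((u + α) * (u + β) * (u + v)) * y 1) ∎) (*-congʳ (+-congˡ (sym fromℕ-1)))))
    where
    -- The four nested operators at index 0, unfolded in the syntax of the solver.
    four = λ y₀ y₁ y₂ y₃ y₄ u v α β →
      let b₀ = y₁ :+ β :* y₀; b₁ = y₂ :+ β :* y₁; b₂ = y₃ :+ β :* y₂; b₃ = y₄ :+ β :* y₃
          a₀ = b₁ :+ α :* b₀; a₁ = b₂ :+ α :* b₁; a₂ = b₃ :+ α :* b₂
          v₀ = a₁ :+ v :* a₀; v₁ = a₂ :+ v :* a₁
      in v₁ :+ u :* v₀

  -- The moments of X vᵢ uⱼ.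

  module Moments (α β : Carrier) (α+β≈1 : α + β ≈ 1#) (a : Series) (tel : Telescopes a β α) where

    open Centred α β α+β≈1 a tel

    private
      P N : Series → Series
      P = (X+ α) ∘ (X+ α) ∘ (X+ β)
      N = (X+ (- α)) ∘ (X+ (- α)) ∘ (X+ (- β))

      P-eq = X+-equivariant α ∘ᵉ X+-equivariant α ∘ᵉ X+-equivariant β
      N-eq = X+-equivariant (- α) ∘ᵉ X+-equivariant (- α) ∘ᵉ X+-equivariant (- β)

    X-1≋ : ∀ {s t} → s + - 1# ≈ - t → ∀ y → τ 1# ((X+ s) y) ≋ (X+ (- t)) (τ 1# y)
    X-1≋ eq y n = trans (τ-X+ _ y n) (X+-cong {a = τ 1# y} eq (λ _ → refl) n)

    -- (X - α)² (X - β)² annihilates f ↦ f′(α) and f ↦ f′(β).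
    Reflects-a : Reflects P N β a
    Reflects-a n = begin
      τ 1# ((X+ β) ((X+ α) ((X+ α) ((X+ β) a)))) n
        ≈⟨ X-1≋ β-1≈-α _ n ⟩
      (X+ (- α)) (τ 1# ((X+ α) ((X+ α) ((X+ β) a)))) n
        ≈⟨ A.cong (λ k → trans (X-1≋ α-1≈-β _ k) (B′.cong (λ l → trans (X-1≋ α-1≈-β _ l) (B′.cong
            (X-1≋ β-1≈-α a) l)) k)) n ⟩
      W (τ 1# a) n
        ≈⟨ W.cong tel n ⟩
      W (a ⊹ 1# · δ β ⊹ - 1# · δ α) n
        ≈⟨ trans (W.homo-⊹ (a ⊹ 1# · δ β) (- 1#) (δ α) n) (+-congʳ (W.homo-⊹ a 1# (δ β) n)) ⟩
      W a n + 1# * W (δ β) n + - 1# * W (δ α) n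
        ≈⟨ +-cong (+-congˡ (*-congˡ (Wδβ n))) (*-congˡ (Wδα n)) ⟩
      W a n + 1# * 0# + - 1# * 0#
        ≈⟨ solve 1 (λ x → x :+ con (+ 1) :* con (+ 0) :+ :- con (+ 1) :* con (+ 0) := x) refl _ ⟩
      (X+ (- α)) ((X+ (- β)) ((X+ (- β)) ((X+ (- α)) a))) n
        ≈⟨ X+-comm (- α) (- β) ((X+ (- β)) ((X+ (- α)) a)) n ⟩
      (X+ (- β)) ((X+ (- α)) ((X+ (- β)) ((X+ (- α)) a))) n
        ≈⟨ B′.cong (A.cong (X+-comm (- β) (- α) a)) n ⟩
      (X+ (- β)) ((X+ (- α)) ((X+ (- α)) ((X+ (- β)) a))) n ∎
      where
      module A = Equivariant (X+-equivariant (- α))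
      module B′ = Equivariant (X+-equivariant (- β))
      W : Series → Series
      W = (X+ (- α)) ∘ (X+ (- β)) ∘ (X+ (- β)) ∘ (X+ (- α))
      module W = Equivariant (X+-equivariant (- α) ∘ᵉ X+-equivariant (- β) ∘ᵉ X+-equivariant
          (- β) ∘ᵉ X+-equivariant (- α))
      module BB = Equivariant (X+-equivariant (- β) ∘ᵉ X+-equivariant (- β))
      module AA = Equivariant (X+-equivariant (- α) ∘ᵉ X+-equivariant (- α))
      Wδα : W (δ α) ≋ 𝟎
      Wδα k = begin
        W (δ α) k
          ≈⟨ BB.comm (- α) ((X+ (- α)) (δ α)) k ⟨
        (X+ (- β)) ((X+ (- β)) ((X+ (- α)) ((X+ (- α)) (δ α)))) k
          ≈⟨ BB.cong (λ l → trans (A.cong (X-y-δ α) l) (X-y-power α l)) k ⟩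
        (X+ (- β)) ((X+ (- β)) 𝟎) k
          ≈⟨ BB.homo-𝟎 k ⟩
        0# ∎
      Wδβ : W (δ β) ≋ 𝟎
      Wδβ k = begin
        W (δ β) k
          ≈⟨ A.cong (BB.comm (- α) (δ β)) k ⟩
        (X+ (- α)) ((X+ (- α)) ((X+ (- β)) ((X+ (- β)) (δ β)))) k
          ≈⟨ AA.cong (λ l → trans (B′.cong (X-y-δ β) l) (X-y-power β l)) k ⟩
        (X+ (- α)) ((X+ (- α)) 𝟎) k
          ≈⟨ AA.homo-𝟎 k ⟩
        0# ∎

    u : ℕ → Series
    u j = newton E² (nodes β) j a

    vu : ℕ → ℕ → Series
    vu i j = newton E² (nodes α) i (u j)

    Reflects-u : ∀ j → Reflects P N (β + fromℕ j) (u j)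
    Reflects-u = Reflects-newton P-eq N-eq β a Reflects-a

    -- The factor X + β + j reached by `Reflects-u` trades places with one of the two copies of X +
    -- α in `P`, so that the products at α can now grow in turn. This is why `P` and `N` contain α
    -- twice.
    Reflects-vu : ∀ i j → Reflects ((X+ (β + fromℕ j)) ∘ (X+ α) ∘ (X+ β)) ((X+ (-
        (β + fromℕ j))) ∘ (X+ (- α)) ∘ (X+ (- β)))
                             (α + fromℕ i) (vu i j)
    Reflects-vu i j = Reflects-newton
      (X+-equivariant _ ∘ᵉ X+-equivariant α ∘ᵉ X+-equivariant β)
      (X+-equivariant _ ∘ᵉ X+-equivariant (- α) ∘ᵉ X+-equivariant (- β))
      α (u j)
      (λ n → trans (τ.cong 1# (X+-comm α (β + fromℕ j) ((X+ α) ((X+ β) (u j)))) n) (trans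
          (Reflects-u j n) (X+-comm (- (β + fromℕ j)) (- α) ((X+ (- α)) ((X+ (- β)) (u j))) n)))
      i

    -- Equals (-1)ⁱ i! · 2α (2α + 1) ⋯ (2α + i - 1).
    w : Carrier → ℕ → Carrier
    w α zero    = 1#
    w α (suc i) = - ((1# + fromℕ i) * (α + α + fromℕ i)) * w α i

    M-recurrenceᵢ : ∀ i j → (1# + fromℕ (suc (i ℕ.+ j))) * vu (suc i) j 1 ≈
      - ((α + α + fromℕ i) * (1# + fromℕ i) * (1# + fromℕ (i ℕ.+ j))) * vu i j 1
    M-recurrenceᵢ i j = begin
      (1# + fromℕ (suc (i ℕ.+ j))) * vu (suc i) j 1
        ≈⟨ *-congʳ (trans (+-cong (sym α+β≈1) (trans (fromℕ-suc (i ℕ.+ j)) (+-cong (sym α+β≈1)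
            (fromℕ-+ i j))))
             (solve 4 (λ α β i j → α :+ β :+ (α :+ β :+ (i :+ j)) := α :+ i :+
                 (β :+ j) :+ α :+ β) refl α β _ _)) ⟩
      (α + fromℕ i + (β + fromℕ j) + α + β) * vu (suc i) j 1
        ≈⟨ Reflects-value _ _ α β (vu i j) (Reflects-vu i j) ⟩
      - ((α + fromℕ i + α) * (α + fromℕ i + β) * (α + fromℕ i + (β + fromℕ j))) * vu i j 1
        ≈⟨ *-congʳ (-‿cong (trans (solve 4 (λ α β i j → (α :+ i :+ α) :* (α :+ i :+ β) :*
            (α :+ i :+ (β :+ j))
              := (α :+ α :+ i) :* (α :+ β :+ i) :* (α :+ β :+ (i :+ j))) refl α β _ _)
             (*-cong (*-congˡ (+-congʳ α+β≈1)) (+-cong α+β≈1 (sym (fromℕ-+ i j)))))) ⟩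
      - ((α + α + fromℕ i) * (1# + fromℕ i) * (1# + fromℕ (i ℕ.+ j))) * vu i j 1 ∎

    -- The recurrence along the edge i = 0, where `Reflects-u` is used with α itself in the role of
    -- v; `M-recurrenceᵢ` fills in the rest from this edge.
    M-recurrenceⱼ : ∀ j → (1# + fromℕ (suc j)) * u (suc j) 1 ≈
      - ((β + β + fromℕ j) * (1# + fromℕ j) * (1# + fromℕ j)) * u j 1
    M-recurrenceⱼ j = begin
      (1# + fromℕ (suc j)) * u (suc j) 1
        ≈⟨ *-congʳ (trans (+-cong (sym α+β≈1) (trans (fromℕ-suc j) (+-congʳ (sym α+β≈1))))
             (solve 3 (λ α β j → α :+ β :+ (α :+ β :+ j) := β :+ j :+ α :+ α :+ β) refl α β _)) ⟩
      (β + fromℕ j + α + α + β) * u (suc j) 1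
        ≈⟨ Reflects-value _ _ α β (u j) (Reflects-u j) ⟩
      - ((β + fromℕ j + α) * (β + fromℕ j + β) * (β + fromℕ j + α)) * u j 1
        ≈⟨ *-congʳ (-‿cong (trans (solve 3 (λ α β j → (β :+ j :+ α) :* (β :+ j :+ β) :* (β :+ j :+ α)
              := (β :+ β :+ j) :* (α :+ β :+ j) :* (α :+ β :+ j)) refl α β _)
             (*-cong (*-congˡ (+-congʳ α+β≈1)) (+-congʳ α+β≈1)))) ⟩
      - ((β + β + fromℕ j) * (1# + fromℕ j) * (1# + fromℕ j)) * u j 1 ∎

    M-value : ∀ i j → vu i j 1 ≈ (β - α) * w α i * w β j * 1/suc (i ℕ.+ j)
    M-value zero zero = trans a₁≈β-α (trans (solve 1 (λ d → d := d :* con (+ 1) :* con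
        (+ 1) :* con (+ 1)) refl _)
                          (*-congˡ (sym ι.1#-homo)))
    M-value zero (suc j) = 1+fromℕ-cancelˡ (suc j) (begin
      (1# + fromℕ (suc j)) * u (suc j) 1
        ≈⟨ M-recurrenceⱼ j ⟩
      - ((β + β + fromℕ j) * (1# + fromℕ j) * (1# + fromℕ j)) * u j 1
        ≈⟨ *-congˡ (M-value zero j) ⟩
      - ((β + β + fromℕ j) * (1# + fromℕ j) * (1# + fromℕ j)) * ((β - α) * 1# * w β j * 1/suc j)
        ≈⟨ solve 5 (λ b c d e y → (:- (b :* c :* c)) :* (d :* con (+ 1) :* e :* y)
              := d :* con (+ 1) :* ((:- (c :* b)) :* e) :* (y :* c)) refl (β + β + fromℕ j)
                  (1# + fromℕ j) (β - α) (w β j) (1/suc j) ⟩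
      (β - α) * 1# * w β (suc j) * (1/suc j * (1# + fromℕ j))
        ≈⟨ *-congˡ (trans (1/suc-inverse j) (sym (1/suc-inverse (suc j)))) ⟩
      (β - α) * 1# * w β (suc j) * (1/suc (suc j) * (1# + fromℕ (suc j)))
        ≈⟨ solve 3 (λ x y z → x :* (y :* z) := z :* (x :* y)) refl _ _ _ ⟩
      (1# + fromℕ (suc j)) * ((β - α) * 1# * w β (suc j) * 1/suc (suc j)) ∎)
    M-value (suc i) j = 1+fromℕ-cancelˡ (suc (i ℕ.+ j)) (begin
      (1# + fromℕ (suc (i ℕ.+ j))) * vu (suc i) j 1
        ≈⟨ M-recurrenceᵢ i j ⟩
      - ((α + α + fromℕ i) * (1# + fromℕ i) * (1# + fromℕ (i ℕ.+ j))) * vu i j 1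
        ≈⟨ *-congˡ (M-value i j) ⟩
      - ((α + α + fromℕ i) * (1# + fromℕ i) * (1# + fromℕ (i ℕ.+ j))) *
          ((β - α) * w α i * w β j * 1/suc (i ℕ.+ j))
        ≈⟨ solve 7 (λ b c k d e f y → (:- (b :* c :* k)) :* (d :* e :* f :* y)
              := d :* ((:- (c :* b)) :* e) :* f :* (y :* k)) refl (α + α + fromℕ i) (1# + fromℕ i)
                  (1# + fromℕ (i ℕ.+ j)) (β - α) (w α i) (w β j) _ ⟩
      (β - α) * w α (suc i) * w β j * (1/suc (i ℕ.+ j) * (1# + fromℕ (i ℕ.+ j)))
        ≈⟨ *-congˡ (trans (1/suc-inverse (i ℕ.+ j)) (sym (1/suc-inverse (suc (i ℕ.+ j))))) ⟩
      (β - α) * w α (suc i) * w β j * (1/suc (suc (i ℕ.+ j)) * (1# + fromℕ (suc (i ℕ.+ j))))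
        ≈⟨ solve 3 (λ x y z → x :* (y :* z) := z :* (x :* y)) refl _ _ _ ⟩
      (1# + fromℕ (suc (i ℕ.+ j))) * ((β - α) * w α (suc i) * w β j * 1/suc (suc (i ℕ.+ j))) ∎)

  -- Legendre elimination

  module Elimination (α β : Carrier) (α+β≈1 : α + β ≈ 1#) (a : Series) (tel : Telescopes a β α) where

    open Moments α β α+β≈1 a tel public
    open Centred α β α+β≈1 a tel public

    -- The ratio of `K n (suc i)` to `K n i`, stated in advance so that no division by `K` occurs.
    ρ : ℕ → ℕ → Carrier
    ρ n i = - ((1# + (fromℕ i + fromℕ n)) * (1# + (fromℕ i + fromℕ n)) * (α + α + (fromℕ i + fromℕ n)))
            * 1/suc (double n ℕ.+ i)

    -- The ratio of the moments of `elim n (suc i)` and `elim n i` against uₙ, so that their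
    -- combination vanishes there: besides `ρ n i` it contains G n (i + n + 1) / G n (i + n) = (i +
    -- n + 1) / (2n + i + 2).
    γ : ℕ → ℕ → Carrier
    γ n i = ρ n i * (1# + (fromℕ i + fromℕ n)) * 1/suc (suc (double n ℕ.+ i))

    -- elim X n i is a monic polynomial of degree n + i in X.
    elim : (Series → Series) → ℕ → ℕ → Series → Series
    elim X zero    i b = newton X (nodes α) i b
    elim X (suc n) i b = elim X n (suc i) b ⊹ - γ n i · elim X n i b

    elim-linear : ∀ {X} → Linear X → ∀ n i → Linear (elim X n i)
    elim-linear X zero    i = newton-linear X i
    elim-linear X (suc n) i = record
      { cong   = λ a≋b → ⊹-cong (P.cong a≋b) refl (Q.cong a≋b)
      ; homo-⊹ = λ a t b k → trans
          (+-cong (P.homo-⊹ a t b k) (*-congˡ (Q.homo-⊹ a t b k)))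
          (solve 6 (λ x y t u v w → x :+ t :* y :+ u :* (v :+ t :* w) := x :+ u :* v :+ t :*
              (y :+ u :* w))
            refl _ _ t (- γ n i) _ _)
      }
      where module P = Linear (elim-linear X n (suc i))
            module Q = Linear (elim-linear X n i)

    module _ {φ X Y : Series → Series} (φ-linear : Linear φ) (Y-linear : Linear Y)
             (φX≋Yφ : ∀ a → φ (X a) ≋ Y (φ a)) where

      elim-natural : ∀ n i b → φ (elim X n i b) ≋ elim Y n i (φ b)
      elim-natural zero    i b = newton-natural φ-linear Y-linear φX≋Yφ (nodes α) i b
      elim-natural (suc n) i b k = trans (Linear.homo-⊹ φ-linear _ (- γ n i) _ k)
        (+-cong (elim-natural n (suc i) b k) (*-congˡ (elim-natural n i b k)))

    K : ℕ → ℕ → Carrier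
    K zero    i = (β - α) * w α i
    K (suc n) i = K n (suc i) * (1# + fromℕ n) * 1/suc (suc (double n ℕ.+ i))

    K-suc : ∀ n i → K n (suc i) ≈ ρ n i * K n i
    K-suc zero i = begin
      (β - α) * (- (I * (α + α + fromℕ i)) * w α i)
        ≈⟨ solve 4 (λ d c b e → d :* ((:- (c :* b)) :* e) := (:- (con (+ 1) :* c :* b)) :*
            (d :* e)) refl _ I _ _ ⟩
      - (1# * I * (α + α + fromℕ i)) * ((β - α) * w α i)
        ≈⟨ *-congʳ (-‿cong (*-congʳ (*-congʳ (sym (1/suc-inverse i))))) ⟩
      - (1/suc i * I * I * (α + α + fromℕ i)) * ((β - α) * w α i)
        ≈⟨ *-congʳ (solve 3 (λ y c b → :- (y :* c :* c :* b) := (:- (c :* c :* b)) :* y) refl _ I _) ⟩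
      - (I * I * (α + α + fromℕ i)) * 1/suc i * ((β - α) * w α i)
        ≈⟨ *-congʳ (*-congʳ (-‿cong (*-cong (*-cong I≈ I≈) (+-congˡ i≈)))) ⟩
      ρ zero i * ((β - α) * w α i) ∎
      where
      I = 1# + fromℕ i
      i≈ : fromℕ i ≈ fromℕ i + fromℕ 0
      i≈ = sym (trans (+-congˡ fromℕ-0) (+-identityʳ _))
      I≈ : I ≈ 1# + (fromℕ i + fromℕ 0)
      I≈ = +-congˡ i≈
    K-suc (suc n) i = begin
      K n (suc (suc i)) * N * 1/suc (suc (double n ℕ.+ suc i))
        ≈⟨ *-congʳ (*-congʳ (K-suc n (suc i))) ⟩
      - (1+i+n * 1+i+n * (α + α + i+n)) * 1/suc (double n ℕ.+ suc i) * K n (suc i) * N * 1/suc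
          (suc (double n ℕ.+ suc i))
        ≈⟨ *-cong (*-congʳ (*-congʳ (*-cong (-‿cong (*-cong (*-cong (+-congˡ shift)
            (+-congˡ shift)) (+-congˡ shift)))
             (reflexive (≡.cong 1/suc (ℕₚ.+-suc (double n) i)))))) (reflexive (≡.cong
                 (1/suc ∘ suc) (ℕₚ.+-suc (double n) i))) ⟩
      - (r * r * r′) * 1/suc (suc (double n ℕ.+ i)) * K n (suc i) * N * 1/suc (suc (suc
          (double n ℕ.+ i)))
        ≈⟨ solve 5 (λ r x k N y → r :* x :* k :* N :* y := r :* y :* (k :* N :* x)) refl _ _ _ N _ ⟩
      ρ (suc n) i * K (suc n) i ∎
      where
      N = 1# + fromℕ n
      i+n = fromℕ (suc i) + fromℕ n
      1+i+n = 1# + i+n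
      r = 1# + (fromℕ i + fromℕ (suc n))
      r′ = α + α + (fromℕ i + fromℕ (suc n))
      shift : i+n ≈ fromℕ i + fromℕ (suc n)
      shift = trans (+-congʳ (fromℕ-suc i)) (trans (solve 2 (λ i n → con (+ 1) :+ i :+ n := i :+
          (con (+ 1) :+ n)) refl _ _)
                (+-congˡ (sym (fromℕ-suc n))))

    -- ∏_{l ≤ n} 1 / (s + 1 + l)
    G : ℕ → ℕ → Carrier
    G zero    s = 1/suc s
    G (suc n) s = G n s * 1/suc (suc (n ℕ.+ s))

    G-suc : ∀ n s → G n (suc s) ≈ (1# + fromℕ s) * G (suc n) s
    G-suc zero s = begin
      1/suc (suc s)                                ≈⟨ *-identityˡ _ ⟨
      1# * 1/suc (suc s)                           ≈⟨ *-congʳ (1/suc-inverse s) ⟨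
      1/suc s * (1# + fromℕ s) * 1/suc (suc s)     ≈⟨ solve 3 (λ x y z → x :* y :* z := y :*
          (x :* z)) refl _ _ _ ⟩
      (1# + fromℕ s) * (1/suc s * 1/suc (suc s))   ∎
    G-suc (suc n) s = trans
      (*-cong (G-suc n s) (reflexive (≡.cong (1/suc ∘ suc) (ℕₚ.+-suc n s)))) (*-assoc _ _ _)

    -- The falling factorial j (j - 1) ⋯ (j - n + 1), whose zeros are the orthogonality relations.
    J : ℕ → ℕ → Carrier
    J zero    j = 1#
    J (suc n) j = (fromℕ j - fromℕ n) * J n j

    J-vanishes : ∀ n j → j < n → J n j ≈ 0#
    J-vanishes (suc n) j (s≤s j≤n) with ℕₚ.m≤n⇒m<n∨m≡n j≤n
    ... | inj₁ j<n = trans (*-congˡ (J-vanishes n j j<n)) (zeroʳ _)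
    ... | inj₂ ≡.refl = trans (*-congʳ (-‿inverseʳ _)) (zeroˡ _)

    J-suc : ∀ n j → (1# + fromℕ j - fromℕ n) * J n (suc j) ≈ (1# + fromℕ j) * J n j
    J-suc zero    j = *-congʳ (trans (+-congˡ (trans (-‿cong fromℕ-0) -0#≈0#)) (+-identityʳ _))
    J-suc (suc n) j = begin
      (1# + fromℕ j - fromℕ (suc n)) * ((fromℕ (suc j) - fromℕ n) * J n (suc j))
        ≈⟨ *-cong (+-congˡ (-‿cong (fromℕ-suc n))) (*-congʳ (+-congʳ (fromℕ-suc j))) ⟩
      (1# + fromℕ j - (1# + fromℕ n)) * ((1# + fromℕ j - fromℕ n) * J n (suc j))
        ≈⟨ *-congˡ (J-suc n j) ⟩
      (1# + fromℕ j - (1# + fromℕ n)) * ((1# + fromℕ j) * J n j)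
        ≈⟨ solve 3 (λ j n x → (con (+ 1) :+ j :- (con (+ 1) :+ n)) :* ((con (+ 1) :+ j) :* x) :=
            (con (+ 1) :+ j) :* ((j :- n) :* x))
             refl _ _ _ ⟩
      (1# + fromℕ j) * ((fromℕ j - fromℕ n) * J n j) ∎

    fromℕ-double : ∀ n → fromℕ (double n) ≈ fromℕ n + fromℕ n
    fromℕ-double zero = trans (sym (+-identityʳ _)) (+-congˡ (sym fromℕ-0))
    fromℕ-double (suc n) = begin
      fromℕ (suc (suc (double n)))   ≈⟨ trans (fromℕ-suc (suc (double n))) (+-congˡ (fromℕ-suc
          (double n))) ⟩
      1# + (1# + fromℕ (double n))   ≈⟨ +-congˡ (+-congˡ (fromℕ-double n)) ⟩
      1# + (1# + (fromℕ n + fromℕ n)) ≈⟨ solve 1 (λ n → con (+ 1) :+ (con (+ 1) :+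
          (n :+ n)) := con (+ 1) :+ n :+ (con (+ 1) :+ n)) refl _ ⟩
      1# + fromℕ n + (1# + fromℕ n)  ≈⟨ +-cong (fromℕ-suc n) (fromℕ-suc n) ⟨
      fromℕ (suc n) + fromℕ (suc n)  ∎

    odd-u : ℕ → Series
    odd-u j = newton tail (nodes β) j (odd a)

    -- `J n j * G n (i + j)` is, up to a constant, the integral over [0, 1] of xʲ against the n-th
    -- derivative of xⁿ⁺ⁱ (1 - x)ⁿ. The elimination thus reproduces Rodrigues' formula, for i = 0
    -- that of the shifted Legendre polynomials.
    elim-value : ∀ n i j → elim tail n i (odd-u j) 0 ≈ K n i * w β j * J n j * G n (i ℕ.+ j)
    elim-value zero i j = begin
      newton tail (nodes α) i (odd-u j) 0
        ≈⟨ Linear.cong (newton-linear {ν = nodes α} tail-linear i)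
            (newton-natural odd-linear tail-linear (λ _ _ → refl) (nodes β) j a) 0 ⟨
      newton tail (nodes α) i (odd (u j)) 0
        ≈⟨ newton-natural odd-linear tail-linear (λ _ _ → refl) (nodes α) i (u j) 0 ⟨
      vu i j 1
        ≈⟨ M-value i j ⟩
      (β - α) * w α i * w β j * 1/suc (i ℕ.+ j)
        ≈⟨ *-congʳ (*-identityʳ _) ⟨
      (β - α) * w α i * w β j * 1# * 1/suc (i ℕ.+ j) ∎
    elim-value (suc n) i j = begin
      elim tail n (suc i) (odd-u j) 0 + - γ n i * elim tail n i (odd-u j) 0
        ≈⟨ +-cong (elim-value n (suc i) j) (*-congˡ (elim-value n i j)) ⟩
      K n (suc i) * W * J n j * G n (suc s) + - (ρ n i * I * z) * (K n i * W * J n j * G n s)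
        ≈⟨ +-cong (*-congˡ (G-suc n s)) (*-congˡ (*-congˡ G≈)) ⟩
      K n (suc i) * W * J n j * ((1# + fromℕ s) * G (suc n) s) + - (ρ n i * I * z) *
          (K n i * W * J n j * (L * G (suc n) s))
        ≈⟨ solve 10 (λ k W J S G r I z k′ L → k :* W :* J :* (S :* G) :+ (:- (r :* I :* z)) :*
            (k′ :* W :* J :* (L :* G))
              := W :* J :* G :* (k :* S :+ (:- (r :* k′)) :* (I :* z :* L))) refl (K n (suc i)) W
                  (J n j) (1# + fromℕ s) (G (suc n) s) (ρ n i) I z (K n i) L ⟩
      W * J n j * G (suc n) s * (K n (suc i) * (1# + fromℕ s) + - (ρ n i * K n i) * (I * z * L))
        ≈⟨ *-congˡ (+-congˡ (*-congʳ (-‿cong (K-suc n i)))) ⟨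
      W * J n j * G (suc n) s * (K n (suc i) * (1# + fromℕ s) + - K n (suc i) * (I * z * L))
        ≈⟨ *-congˡ (solve 3 (λ k S q → k :* S :+ (:- k) :* q := k :* (con
            (+ 1) :* S :- q)) refl _ _ _) ⟩
      W * J n j * G (suc n) s * (K n (suc i) * (1# * (1# + fromℕ s) - I * z * L))
        ≈⟨ *-congˡ (*-congˡ (+-cong (*-cong (sym zZ≈1) (+-congˡ s≈)) (-‿cong (*-congˡ L≈)))) ⟩
      W * J n j * G (suc n) s * (K n (suc i) * (z * Z * (1# + (fromℕ i + fromℕ j)) - I * z * L′))
        -- The elimination rests on (2n + i + 2)(i + j + 1) - (n + i + 1)(n + i + j + 2) = (n + 1)(j
        -- - n): the factor j - n extends `J`, and n + 1 goes into `K`.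
        ≈⟨ solve 8 (λ W J G k z i j n →
              W :* J :* G :* (k :* (z :* (con (+ 1) :+ (con (+ 1) :+ (n :+ n :+ i))) :* (con
                  (+ 1) :+ (i :+ j))
                 :- (con (+ 1) :+ (i :+ n)) :* z :* (con (+ 1) :+ (con (+ 1) :+ (n :+ (i :+ j))))))
              := k :* (con (+ 1) :+ n) :* z :* W :* ((j :- n) :* J) :* G)
             refl W (J n j) (G (suc n) s) (K n (suc i)) z (fromℕ i) (fromℕ j) (fromℕ n) ⟩
      K n (suc i) * (1# + fromℕ n) * z * W * ((fromℕ j - fromℕ n) * J n j) * G (suc n) s ∎
      where
      s = i ℕ.+ j
      W = w β j
      I = 1# + (fromℕ i + fromℕ n)
      z = 1/suc (suc (double n ℕ.+ i))
      Z = 1# + (1# + (fromℕ n + fromℕ n + fromℕ i))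
      L = 1# + fromℕ (suc (n ℕ.+ s))
      L′ = 1# + (1# + (fromℕ n + (fromℕ i + fromℕ j)))
      s≈ : fromℕ s ≈ fromℕ i + fromℕ j
      s≈ = fromℕ-+ i j
      L≈ : L ≈ L′
      L≈ = +-congˡ (trans (fromℕ-suc (n ℕ.+ s)) (+-congˡ (trans (fromℕ-+ n s) (+-congˡ s≈))))
      zZ≈1 : z * Z ≈ 1#
      zZ≈1 = trans (*-congˡ (sym (+-congˡ (trans (fromℕ-suc (double n ℕ.+ i)) (+-congˡ (trans
          (fromℕ-+ (double n) i) (+-congʳ (fromℕ-double n))))))))
                   (1/suc-inverse (suc (double n ℕ.+ i)))
      G≈ : G n s ≈ L * G (suc n) s
      G≈ = begin
        G n s                                ≈⟨ *-identityʳ _ ⟨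
        G n s * 1#                           ≈⟨ *-congˡ (1/suc-inverse (suc (n ℕ.+ s))) ⟨
        G n s * (1/suc (suc (n ℕ.+ s)) * L)  ≈⟨ solve 3 (λ x y z → x :* (y :* z) := z :*
            (x :* y)) refl _ _ _ ⟩
        L * G (suc n) s                      ∎

    h : ℕ → Carrier
    h n = K n 0 * w β n * J n n * G n n

    h₀ : h 0 ≈ β - α
    h₀ = trans (solve 2 (λ d x → d :* con (+ 1) :* con (+ 1) :* con (+ 1) :* x := d :* x) refl _ _)
           (trans (*-congˡ ι.1#-homo) (*-identityʳ _))

    -- With ℓ = n + 1 the denominators are 2ℓ - 1 and 2ℓ + 1, and for α, β = (1 ± D)/2 the product
    -- (2α + n)(2β + n) is ℓ² - D².
    h-suc : ∀ n → let N = fromℕ n; N′ = 1# + N in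
      fromℕ 4 * ((1# + (N + N)) * (1# + (1# + (1# + (N + N))))) * h (suc n)
      ≈ N′ * N′ * N′ * N′ * ((α + α + N) * (β + β + N)) * h n
    h-suc n = begin
      fromℕ 4 * (X₁ * X₃) * (K (suc n) 0 * w β (suc n) * J (suc n) (suc n) * G (suc n) (suc n))
        ≈⟨ *-congˡ (*-cong (*-cong (*-cong K≈ refl) J≈) G≈) ⟩
      fromℕ 4 * (X₁ * X₃) * (- (N′ * N′ * (α + α + N)) * i₁ * K n 0 * N′ * i₂
                       * (- (N′ * (β + β + N)) * w β n)
                       * (N′ * J n n) * (N′ * (G n n * i₂) * i₃))
        -- Six factors n + 1 accumulate from `K`, `w`, `J` and `G`. Since 2n + 2 = 2 (n + 1), the
        -- two inverses of 2n + 2 absorb two of them together with the constant 4, leaving the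
        -- fourth power.
        ≈⟨ solve 12 (λ i₁ X₁ i₂ i₃ X₃ n α2 β2 k w J G →
              let N′ = con (+ 1) :+ n; X₂ = con (+ 1) :+ (con (+ 1) :+ (n :+ n)) in
              con (+ 4) :* (X₁ :* X₃) :* ((:- (N′ :* N′ :* α2)) :* i₁ :* k :* N′ :* i₂
                       :* ((:- (N′ :* β2)) :* w)
                       :* (N′ :* J) :* (N′ :* (G :* i₂) :* i₃))
              := (i₁ :* X₁) :* (i₂ :* X₂) :* (i₂ :* X₂) :* (i₃ :* X₃) :* (N′ :* N′ :* N′ :* N′ :*
                  (α2 :* β2) :* (k :* w :* J :* G)))
            refl i₁ X₁ i₂ i₃ X₃ N (α + α + N) (β + β + N) (K n 0) (w β n) (J n n) (G n n) ⟩
      i₁ * X₁ * (i₂ * X₂) * (i₂ * X₂) * (i₃ * X₃) * (N′ * N′ * N′ * N′ * ((α + α + N) *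
          (β + β + N)) * h n)
        ≈⟨ *-congʳ (*-cong (*-cong (*-cong iX₁ iX₂) iX₂) iX₃) ⟩
      1# * 1# * 1# * 1# * (N′ * N′ * N′ * N′ * ((α + α + N) * (β + β + N)) * h n)
        ≈⟨ solve 1 (λ x → con (+ 1) :* con (+ 1) :* con (+ 1) :* con (+ 1) :* x := x) refl _ ⟩
      N′ * N′ * N′ * N′ * ((α + α + N) * (β + β + N)) * h n ∎
      where
      N N′ X₁ X₂ X₃ i₁ i₂ i₃ : Carrier
      N = fromℕ n
      N′ = 1# + N
      X₁ = 1# + (N + N)
      X₂ = 1# + (1# + (N + N))
      X₃ = 1# + (1# + (1# + (N + N)))
      i₁ = 1/suc (double n)
      i₂ = 1/suc (suc (double n))
      i₃ = 1/suc (suc (suc (double n)))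
      X₂≈ : 1# + fromℕ (suc (double n)) ≈ X₂
      X₂≈ = +-congˡ (trans (fromℕ-suc (double n)) (+-congˡ (fromℕ-double n)))
      iX₁ : i₁ * X₁ ≈ 1#
      iX₁ = trans (*-congˡ (+-congˡ (sym (fromℕ-double n)))) (1/suc-inverse (double n))
      iX₂ : i₂ * X₂ ≈ 1#
      iX₂ = trans (*-congˡ (sym X₂≈)) (1/suc-inverse (suc (double n)))
      iX₃ : i₃ * X₃ ≈ 1#
      iX₃ = trans (*-congˡ (sym (+-congˡ (trans (fromℕ-suc (suc (double n))) X₂≈))))
          (1/suc-inverse (suc (suc (double n))))
      n≈ : fromℕ 0 + N ≈ N
      n≈ = trans (+-congʳ fromℕ-0) (+-identityˡ N)
      K≈ : K (suc n) 0 ≈ - (N′ * N′ * (α + α + N)) * i₁ * K n 0 * N′ * i₂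
      K≈ = *-cong (*-congʳ (trans (K-suc n 0) (*-congʳ (*-cong (-‿cong (*-cong (*-cong
          (+-congˡ n≈) (+-congˡ n≈)) (+-congˡ n≈)))
             (reflexive (≡.cong 1/suc (ℕₚ.+-identityʳ (double n)))))))) (reflexive (≡.cong
                 (1/suc ∘ suc) (ℕₚ.+-identityʳ (double n))))
      J≈ : J (suc n) (suc n) ≈ N′ * J n n
      J≈ = trans (*-congʳ (+-congʳ (fromℕ-suc n))) (J-suc n n)
      n+n≡ : ∀ n → n ℕ.+ n ≡ double n
      n+n≡ zero    = ≡.refl
      n+n≡ (suc n) = ≡.cong suc (≡.trans (ℕₚ.+-suc n n) (≡.cong suc (n+n≡ n)))
      G≈ : G (suc n) (suc n) ≈ N′ * (G n n * i₂) * i₃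
      G≈ = *-cong (trans (G-suc n n) (*-congˡ (*-congˡ (reflexive (≡.cong (1/suc ∘ suc) (n+n≡ n))))))
                  (reflexive (≡.cong (1/suc ∘ suc) (≡.trans (ℕₚ.+-suc n n) (≡.cong suc (n+n≡ n)))))

    orthogonal : ℕ → (Series → Series) → Series → Series
    orthogonal k X = elim X k 0

    private
      odd-p : ℕ → Series
      odd-p k = orthogonal k tail (odd a)

      -- The product defining uⱼ commutes with the elimination, so `elim-value`, where uⱼ is applied
      -- first, also gives the moments of pₖ against uⱼ.
      newton-odd-p : ∀ k j → newton tail (nodes β) j (odd-p k) 0 ≈ K k 0 * w β j * J k j * G k j
      newton-odd-p k j = trans
        (elim-natural (newton-linear {ν = nodes β} tail-linear j) tail-linear (λ b n → sym
            (newton-natural tail-linear tail-linear (λ _ _ → refl) (nodes β) j b n)) k 0 (odd a) 0)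
        (elim-value k 0 j)

      odd-p-vanishes : ∀ k → Vanishes k (odd-p k)
      odd-p-vanishes k = newton-tail-vanishes (nodes β) k (λ j j<k → trans (newton-odd-p k j)
        (trans (*-congʳ (trans (*-congˡ (J-vanishes k j j<k)) (zeroʳ _))) (zeroˡ _)))

    orthogonal-odd : ∀ k → odd (orthogonal k E² a) ≋ odd-p k
    orthogonal-odd k = elim-natural odd-linear tail-linear (λ _ _ → refl) k 0 a

    orthogonal-even : ∀ k → even (orthogonal k E² a) ≋ 𝟎
    orthogonal-even k n = trans (elim-natural even-linear tail-linear (λ _ _ → refl) k 0 a n)
      (trans (E.cong even-vanishes n) (E.homo-𝟎 n))
      where module E = Linear (elim-linear tail-linear k 0)

    -- As uₖ is monic of degree k in X² and lower odd moments vanish, X²ᵏ⁺¹ may be replaced by X uₖ.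
    orthogonal-leading : ∀ k → orthogonal k E² a (suc (double k)) ≈ h k
    orthogonal-leading k = trans (orthogonal-odd k k)
      (trans (sym (newton-tail-leading₀ (nodes β) k (odd-p-vanishes k))) (newton-odd-p k k))

    orthogonal-vanishes : ∀ k → Vanishes (suc (double k)) (orthogonal k E² a)
    orthogonal-vanishes k = go k (λ j _ → orthogonal-even k j) (λ j j<k → trans
        (orthogonal-odd k j) (odd-p-vanishes k j j<k))
      where
      go : ∀ k {p : Series} → (∀ j → j ≤ k → p (double j) ≈ 0#) → (∀ j → j < k → p (suc
          (double j)) ≈ 0#) → Vanishes (suc (double k)) p
      go k       ev od zero          _ = ev 0 z≤n
      go (suc k) ev od (suc zero)    _ = od 0 (s≤s z≤n)
      go (suc k) ev od (suc (suc j)) (s≤s (s≤s j<)) =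
        go k (λ i i≤k → ev (suc i) (s≤s i≤k)) (λ i i<k → od (suc i) (s≤s i<k)) j j<
      go zero    ev od (suc j) (s≤s ())

  -- Hankel determinants

  -- The entry at (2k + 1, 2k + 1) is left free, since it does not affect the determinant of the
  -- block.
  record AntidiagonalBlocks (σ : ℕ → Series) (h : ℕ → Carrier) : Set ℓ where
    field
      even-vanishes : ∀ k → Vanishes (suc (double k)) (σ (double k))
      even-leading  : ∀ k → σ (double k) (suc (double k)) ≈ h k
      odd-vanishes  : ∀ k → Vanishes (double k) (σ (suc (double k)))
      odd-leading   : ∀ k → σ (suc (double k)) (double k) ≈ h k

    column₀ : ∀ n → σ (suc (suc n)) 0 ≈ 0#
    column₀ = parity-elim _ (λ k → even-vanishes (suc k) 0 (s≤s z≤n)) (λ k → odd-vanishes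
        (suc k) 0 (s≤s z≤n))

    column₁ : ∀ n → σ (suc (suc n)) 1 ≈ 0#
    column₁ = parity-elim _ (λ k → even-vanishes (suc k) 1 (s≤s (s≤s z≤n))) (λ k → odd-vanishes
        (suc k) 1 (s≤s (s≤s z≤n)))

    subblocks : AntidiagonalBlocks (λ n j → σ (suc (suc n)) (suc (suc j))) (h ∘ suc)
    subblocks = record
      { even-vanishes = λ k j j< → even-vanishes (suc k) (suc (suc j)) (s≤s (s≤s j<))
      ; even-leading  = even-leading ∘ suc
      ; odd-vanishes  = λ k j j< → odd-vanishes (suc k) (suc (suc j)) (s≤s (s≤s j<))
      ; odd-leading   = odd-leading ∘ suc
      }

    det-block : ∀ n → det {suc (suc n)} (toMatrix σ) ≈
                - (h 0 * h 0 * det {n} (toMatrix (λ n j → σ (suc (suc n)) (suc (suc j)))))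
    det-block n = trans
      (det-antidiagonal-block {n} {toMatrix σ} (even-vanishes 0 0 (s≤s z≤n)) (λ i → column₀
          (toℕ i)) (λ i → column₁ (toℕ i)))
      (-‿cong (*-congʳ (*-cong (even-leading 0) (odd-leading 0))))

  blockProduct : ℕ → (ℕ → Carrier) → Carrier
  blockProduct zero    h = 1#
  blockProduct (suc m) h = - (h 0 * h 0 * blockProduct m (h ∘ suc))

  det-even-size : ∀ m {σ h} → AntidiagonalBlocks σ h → det {double m} (toMatrix σ) ≈ blockProduct m h
  det-even-size zero    blocks = refl
  det-even-size (suc m) blocks = trans (det-block (double m)) (-‿cong (*-congˡ
      (det-even-size m subblocks)))
    where open AntidiagonalBlocks blocks

  -- After m blocks have been removed, the single entry at (2m, 2m) remains, and it is zero.
  det-odd-size : ∀ m {σ h} → AntidiagonalBlocks σ h → det {suc (double m)} (toMatrix σ) ≈ 0#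
  det-odd-size zero {σ} blocks = trans (+-identityʳ _) (trans (*-identityʳ _) (trans (*-congˡ
      (even-vanishes 0 0 (s≤s z≤n))) (zeroʳ _)))
    where open AntidiagonalBlocks blocks
  det-odd-size (suc m) blocks = trans (det-block (suc (double m)))
    (trans (-‿cong (trans (*-congˡ (det-odd-size m subblocks)) (zeroʳ _))) -0#≈0#)
    where open AntidiagonalBlocks blocks

  -- Monic polynomials as row operations on the Hankel matrix.

  module Monic (b : Series) where

    shift : ℕ → Series
    shift d j = b (d ℕ.+ j)

    tail-shift : ∀ n → tail (shift n) ≋ shift (suc n)
    tail-shift n j = reflexive (≡.cong b (ℕₚ.+-suc n j))

    span-cong : ∀ {n a a′} → a ≋ a′ → Span shift n a → Span shift n a′
    span-cong a≋ (none a≈0)      = none (λ j → trans (sym (a≋ j)) (a≈0 j))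
    span-cong a≋ (more t sp a≈)  = more t sp (λ j → trans (sym (a≋ j)) (a≈ j))

    span-⊹ : ∀ {n a a′} t → Span shift n a → Span shift n a′ → Span shift n (a ⊹ t · a′)
    span-⊹ t (none a≈0) (none a′≈0) = none (λ j → trans (+-cong (a≈0 j) (trans (*-congˡ (a′≈0 j))
        (zeroʳ t))) (+-identityʳ _))
    span-⊹ t (more u sp a≈) (more v sp′ a′≈) = more (u + t * v) (span-⊹ t sp sp′) (λ j → trans
      (+-cong (a≈ j) (*-congˡ (a′≈ j)))
      (solve 6 (λ x u y t z v → x :+ u :* y :+ t :* (z :+ v :* y) := x :+ t :* z :+
          (u :+ t :* v) :* y) refl _ u _ t _ v))

    span-suc : ∀ {n a} → Span shift n a → Span shift (suc n) a
    span-suc sp = more 0# sp (λ j → sym (trans (+-congˡ (zeroˡ _)) (+-identityʳ _)))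

    span-tail : ∀ {n a} → Span shift n a → Span shift (suc n) (tail a)
    span-tail (none a≈0)         = span-suc (none (λ j → a≈0 (suc j)))
    span-tail (more {n} t sp a≈) = more t (span-tail sp) (λ j → trans (a≈ (suc j)) (+-congˡ
        (*-congˡ (tail-shift n j))))

    -- `shift d` is row d of the Hankel matrix, that is Xᵈ acting on `b`. A monic polynomial of
    -- degree d acting on `b` is recorded by its effect alone, which is the form that
    -- `det-unitriangular` consumes.
    Monic : ℕ → Series → Set (c ⊔ ℓ)
    Monic d a = Span shift d (a ⊖ shift d)

    monic⇒span : ∀ {d a} → Monic d a → Span shift (suc d) a
    monic⇒span sp = more 1# sp (λ j → solve 2 (λ a s → a := a :- s :+ con (+ 1) :* s) refl _ _)

    monic-⊹ : ∀ {d a a′} t → Monic d a → Span shift d a′ → Monic d (a ⊹ t · a′)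
    monic-⊹ t sp sp′ = span-cong (λ j → solve 4 (λ a s t a′ → a :- s :+ t :* a′ := a :+ t :* a′ :- s) refl _ _ t _) (span-⊹ t sp sp′)

    monic-b : Monic 0 b
    monic-b = none (λ j → -‿inverseʳ (b j))

    monic-X+ : ∀ s {d a} → Monic d a → Monic (suc d) ((X+ s) a)
    monic-X+ s {d} {a} mon = monic-⊹ s
      (span-cong (λ j → +-congˡ (-‿cong (tail-shift d j))) (span-tail mon)) (monic⇒span mon)

  module Hankel (α β : Carrier) (α+β≈1 : α + β ≈ 1#) (s : Carrier) (b : Series)
                (tel : Telescopes (τ s b) β α) where

    open Elimination α β α+β≈1 (τ s b) tel public hiding (even-vanishes)
    open Monic b

    -- Only the rows are recentred: X + s acts on `b` itself, and the columns keep the monomials Xʲ.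
    -- By `τ-vanishes⁻¹` and `τ-leading` this loses nothing, because a translation preserves initial
    -- zeros and the first entry after them.
    Z² : Series → Series
    Z² = (X+ s) ∘ (X+ s)

    monic-newton : ∀ i → Monic (double i) (newton Z² (nodes α) i b)
    monic-newton zero    = monic-b
    monic-newton (suc i) = monic-⊹ _ (monic-X+ s (monic-X+ s (monic-newton i))) (span-suc
        (monic⇒span (monic-newton i)))

    monic-elim : ∀ n i → Monic (double (n ℕ.+ i)) (elim Z² n i b)
    monic-elim zero    i = monic-newton i
    monic-elim (suc n) i = monic-⊹ _
      (≡.subst (λ d → Monic (double d) (elim Z² n (suc i) b)) (ℕₚ.+-suc n i) (monic-elim n (suc i)))
      (span-suc (monic⇒span (monic-elim n i)))

    p : ℕ → Series
    p k = orthogonal k Z² b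

    monic-p : ∀ k → Monic (double k) (p k)
    monic-p k = ≡.subst (λ d → Monic (double d) (p k)) (ℕₚ.+-identityʳ k) (monic-elim k 0)

    σ : ℕ → Series
    σ = interleave p (λ k → (X+ s) (p k))

    monic-σ : ∀ d → Monic d (σ d)
    monic-σ = parity-elim _
      (λ k → ≡.subst (Monic (double k)) (≡.sym (interleave-even p _ k)) (monic-p k))
      (λ k → ≡.subst (Monic (suc (double k))) (≡.sym (interleave-odd p _ k)) (monic-X+ s (monic-p k)))

    τ-p : ∀ k → τ s (p k) ≋ orthogonal k E² (τ s b)
    τ-p k = elim-natural (τ-linear s) E²-linear (λ _ _ → refl) k 0 b

    p-vanishes : ∀ k → Vanishes (suc (double k)) (p k)
    p-vanishes k = τ-vanishes⁻¹ s (suc (double k)) (λ j j< → trans (τ-p k j)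
        (orthogonal-vanishes k j j<))

    p-leading : ∀ k → p k (suc (double k)) ≈ h k
    p-leading k = trans (sym (τ-leading s (suc (double k)) (p-vanishes k))) (trans (τ-p k _)
        (orthogonal-leading k))

    blocks : AntidiagonalBlocks σ h
    blocks = record
      { even-vanishes = λ k → ≡.subst (Vanishes (suc (double k))) (≡.sym (interleave-even p _ k))
          (p-vanishes k)
      ; even-leading  = λ k → trans (reflexive (≡.cong (λ a → a (suc (double k)))
          (interleave-even p _ k))) (p-leading k)
      ; odd-vanishes  = λ k → ≡.subst (Vanishes (double k)) (≡.sym (interleave-odd p _ k))
          (X+-vanishes s (p-vanishes k))
      ; odd-leading   = λ k → trans (reflexive (≡.cong (λ a → a (double k)) (interleave-odd p _ k)))
          (trans (+-cong (p-leading k) (trans (*-congˡ (p-vanishes k (double k) ℕₚ.≤-refl))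
              (zeroʳ s))) (+-identityʳ _))
      }

    det-shift : ∀ n → det {n} (toMatrix shift) ≈ det {n} (toMatrix σ)
    det-shift n = sym (det-unitriangular n monic-σ)

    H-even : ∀ m → H (2 ℕ.* m) b ≈ 0#
    H-even m = ≡.subst (λ n → det {suc n} (toMatrix shift) ≈ 0#) (≡.sym (2*n≡double m))
      (trans (det-shift (suc (double m))) (det-odd-size m blocks))

    H-odd : ∀ m → H (2 ℕ.* m ℕ.+ 1) b ≈ blockProduct (suc m) h
    H-odd m = ≡.subst (λ n → det {suc n} (toMatrix shift) ≈ blockProduct (suc m) h)
      (≡.trans (≡.cong suc (≡.sym (2*n≡double m))) (ℕₚ.+-comm 1 (2 ℕ.* m)))
      (trans (det-shift (double (suc m))) (det-even-size (suc m) blocks))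

  -- The product of the blocks in closed form.

  weightedProduct : ℕ → (ℕ → Carrier) → Carrier
  weightedProduct zero    x = 1#
  weightedProduct (suc m) x = (x 0 * x 0) ^ suc m * weightedProduct m (x ∘ suc)

  -- Each hₖ contributes P²ᵏ, so the squares for k ≤ m contribute P to the power 2m (m + 1), which
  -- is exactly m copies of P attached to each of the 2 (m + 1) factors `h 0`. The n-th `x` occurs
  -- in hₖ for n < k ≤ m, hence m - n times, doubled by squaring.
  blockProduct-closed : ∀ P m (h x : ℕ → Carrier) → (∀ n → h (suc n) ≈ - (P * P * x n) * h n) →
    blockProduct (suc m) h ≈ (- 1#) ^ suc m * (h 0 * P ^ m *
        (h 0 * P ^ m)) ^ suc m * weightedProduct m x
  blockProduct-closed P zero h x step = solve 1 (λ h →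
    :- (h :* h :* con (+ 1)) := (:- con (+ 1) :* con (+ 1)) :* (h :* con (+ 1) :* (h :* con
        (+ 1)) :* con (+ 1)) :* con (+ 1))
    refl (h 0)
  blockProduct-closed P (suc m) h x step = begin
    - (h 0 * h 0 * blockProduct (suc m) (h ∘ suc))
      ≈⟨ -‿cong (*-congˡ (blockProduct-closed P m (h ∘ suc) (x ∘ suc) (step ∘ suc))) ⟩
    - (h 0 * h 0 * (e * (h 1 * P ^ m * (h 1 * P ^ m)) ^ suc m * W))
      ≈⟨ -‿cong (*-congˡ (*-congʳ (*-congˡ (begin
        (h 1 * P ^ m * (h 1 * P ^ m)) ^ suc m
          ≈⟨ ^-congˡ (suc m) (trans (*-cong (*-congʳ (step 0)) (*-congʳ (step 0)))
               (solve 4 (λ P x h p → (:- (P :* P :* x)) :* h :* p :* ((:- (P :* P :* x)) :* h :* p)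
                   := (x :* x) :* ((P :* P) :* (h :* (P :* p) :* (h :* (P :* p))))) refl P (x 0)
                       (h 0) (P ^ m))) ⟩
        (x 0 * x 0 * (P * P * Y)) ^ suc m
          ≈⟨ trans (^-distrib-* (x 0 * x 0) (P * P * Y) (suc m)) (*-congˡ (^-distrib-* (P * P) Y
              (suc m))) ⟩
        X * ((P * P) ^ suc m * Y ^ suc m)
          ≈⟨ *-congˡ (*-congʳ (^-distrib-* P P (suc m))) ⟩
        X * (P ^ suc m * P ^ suc m * Y ^ suc m) ∎)))) ⟩
    - (h 0 * h 0 * (e * (X * (P ^ suc m * P ^ suc m * Y ^ suc m)) * W))
      ≈⟨ solve 6 (λ h e X p y W → :- (h :* h :* (e :* (X :* (p :* p :* y)) :* W))
            := (:- con (+ 1)) :* e :* (h :* p :* (h :* p) :* y) :* (X :* W)) refl (h 0) e X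
                (P ^ suc m) (Y ^ suc m) W ⟩
    - 1# * e * (Y * Y ^ suc m) * (X * W) ∎
    where
    e = (- 1#) ^ suc m
    W = weightedProduct m (x ∘ suc)
    Y = h 0 * P ^ suc m * (h 0 * P ^ suc m)
    X = (x 0 * x 0) ^ suc m

  ι-^ : ∀ p n → ι (p ^ℚ n) ≈ ι p ^ n
  ι-^ p zero    = ι.1#-homo
  ι-^ p (suc n) = trans (ι.*-homo p (p ^ℚ n)) (*-congˡ (ι-^ p n))

  x^2n≈[x*x]^n : ∀ x n → x ^ (2 ℕ.* n) ≈ (x * x) ^ n
  x^2n≈[x*x]^n x n = trans (sym (^-assocʳ x 2 n)) (^-congˡ n (*-congˡ (*-identityʳ x)))

  ι-∏₁ : ∀ m (f : (k : ℕ) → .{{NonZero k}} → ℚ) →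
         ι (∏₁ m (λ l → f l ^ℚ (2 ℕ.* (m ℕ.+ 1 ∸ l)))) ≈ weightedProduct m (λ i → ι (f (suc i)))
  ι-∏₁ zero    f = ι.1#-homo
  -- Removing the factor l = 1 lowers m and l together, so the exponent m + 1 - l of every other
  -- factor is unchanged by computation.
  ι-∏₁ (suc m) f = trans (ι.*-homo _ _) (*-cong
    (trans (ι-^ (f 1) (2 ℕ.* (m ℕ.+ 1))) (trans (x^2n≈[x*x]^n (ι (f 1)) (m ℕ.+ 1)) (^-congʳ (ι
        (f 1) * ι (f 1)) (ℕₚ.+-comm m 1))))
    (ι-∏₁ m (λ k → f (suc k))))

  fromℕ-^ : ∀ q n → fromℕ (q ℕ.^ n) ≈ fromℕ q ^ n
  fromℕ-^ q zero    = fromℕ-1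
  fromℕ-^ q (suc n) = trans (fromℕ-* q (q ℕ.^ n)) (*-congˡ (fromℕ-^ q n))

  1^n≈1 : ∀ n → 1# ^ n ≈ 1#
  1^n≈1 zero    = refl
  1^n≈1 (suc n) = trans (*-identityˡ _) (1^n≈1 n)

  ι-/-* : ∀ i n .{{_ : NonZero n}} → ι (i ℚ./ n) * fromℕ n ≈ ι (i ℚ./ 1)
  ι-/-* i n = trans (sym (ι.*-homo _ _)) (ι.⟦⟧-cong (i/n*n≡i i n))

  fromℤ-pos : ∀ n → fromℤ (+ n) ≈ fromℕ n
  fromℤ-pos n = fromℤ≈ι (+ n)

  -- Specialisation to differences of Bernoulli polynomials.

  module Main (q r s : ℕ) .{{_ : NonZero q}} (x : Carrier) where

    P S D α β y z : Carrier
    P = ι ((+ 1) ℚ./ q)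
    S = fromℕ s - fromℕ r
    D = S * P
    α = 1/suc 1 * (1# + D)
    β = 1/suc 1 * (1# - D)
    y = (x + fromℕ r) /ₙ q
    z = (x + fromℕ s) /ₙ q

    ι-S : ι ((+ s ℤ.- + r) ℚ./ 1) ≈ S
    ι-S = begin
      ι ((+ s ℤ.- + r) ℚ./ 1)         ≈⟨ fromℤ≈ι (+ s ℤ.- + r) ⟨
      fromℤ (+ s ℤ.- + r)             ≈⟨ fromℤ-homo-+ (+ s) (ℤ.- + r) ⟩
      fromℤ (+ s) + fromℤ (ℤ.- + r)   ≈⟨ +-cong (fromℤ-pos s) (trans (fromℤ-homo-neg (+ r))
          (-‿cong (fromℤ-pos r))) ⟩
      S                               ∎

    half+half≈1 : 1/suc 1 + 1/suc 1 ≈ 1#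
    half+half≈1 = trans (trans (solve 1 (λ u → u :+ u := u :* (con (+ 1) :+ con (+ 1))) refl _)
        (*-congˡ (+-congˡ (sym fromℕ-1))))
                    (1/suc-inverse 1)

    α+β≈1 : α + β ≈ 1#
    α+β≈1 = trans (solve 2 (λ u D → u :* (con (+ 1) :+ D) :+ u :* (con
        (+ 1) :- D) := u :+ u) refl _ D) half+half≈1

    α+α≈1+D : α + α ≈ 1# + D
    α+α≈1+D = trans (sym (distribʳ _ _ _)) (trans (*-congʳ half+half≈1) (*-identityˡ _))

    β+β≈1-D : β + β ≈ 1# - D
    β+β≈1-D = trans (sym (distribʳ _ _ _)) (trans (*-congʳ half+half≈1) (*-identityˡ _))

    α-β≈D : α - β ≈ D
    α-β≈D = trans (solve 2 (λ u D → u :* (con (+ 1) :+ D) :- u :* (con (+ 1) :- D) :=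
        (u :+ u) :* D) refl _ D)
              (trans (*-congʳ half+half≈1) (*-identityˡ D))

    y-centred : y + (β - y) ≈ β
    y-centred = solve 2 (λ y β → y :+ (β :- y) := β) refl y β

    z-centred : z + (β - y) ≈ α
    z-centred = begin
      P * (x + fromℕ s) + (β - P * (x + fromℕ r))
        ≈⟨ solve 5 (λ P x s r β → P :* (x :+ s) :+ (β :- P :* (x :+ r)) :=
            (s :- r) :* P :+ β) refl P x _ _ β ⟩
      D + β
        ≈⟨ +-congʳ α-β≈D ⟨
      α - β + β
        ≈⟨ solve 2 (λ α β → α :- β :+ β := α) refl α β ⟩
      α ∎

    b : Series
    b = bernoulliDifference q r s x

    open Hankel α β α+β≈1 (β - y) b
      (Telescopes-cong y-centred z-centred (Telescopes-τ (β - y) (B-difference-telescopes y z))) public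
      using (h; h₀; h-suc; H-even; H-odd)

    Pq≈1 : P * fromℕ q ≈ 1#
    Pq≈1 = 1/-inverse q

    F : ℕ → Carrier
    F n = ι (factor q r s (suc n))

    F-value : ∀ n → let N = fromℕ n; N′ = 1# + N in
      F n * (fromℕ 4 * ((1# + (N + N)) * (1# + (1# + (1# + (N + N)))))) ≈
      N′ * N′ * N′ * N′ * (S * S - (fromℕ q * N′) * (fromℕ q * N′))
    F-value n = begin
      F n * (fromℕ 4 * (X₁ * X₃))
        ≈⟨ *-congˡ denominator ⟨
      F n * fromℕ (4 ℕ.* (2k+1 ℕ.* 2k-1))
        ≈⟨ ι-/-* (k ℤ.^ 4 ℤ.* (d ℤ.^ 2 ℤ.- e ℤ.^ 2)) (4 ℕ.* (2k+1 ℕ.* 2k-1))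
             {{ℕₚ.m*n≢0 4 (2k+1 ℕ.* 2k-1) {{_}} {{ℕₚ.m*n≢0 2k+1 2k-1 {{_}} {{2k∸1≢0 (suc n)}}}}}} ⟩
      ι ((k ℤ.^ 4 ℤ.* (d ℤ.^ 2 ℤ.- e ℤ.^ 2)) ℚ./ 1)
        ≈⟨ fromℤ≈ι (k ℤ.^ 4 ℤ.* (d ℤ.^ 2 ℤ.- e ℤ.^ 2)) ⟨
      fromℤ (k ℤ.^ 4 ℤ.* (d ℤ.^ 2 ℤ.- e ℤ.^ 2))
        ≈⟨ trans (fromℤ-homo-* (k ℤ.^ 4) (d ℤ.^ 2 ℤ.- e ℤ.^ 2)) (*-congˡ (trans (fromℤ-homo-+
            (d ℤ.^ 2) (ℤ.- (e ℤ.^ 2)))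
             (+-congˡ (fromℤ-homo-neg (e ℤ.^ 2))))) ⟩
      fromℤ (k ℤ.^ 4) * (fromℤ (d ℤ.^ 2) - fromℤ (e ℤ.^ 2))
        ≈⟨ *-cong (fromℤ-^ k 4 k≈) (+-cong (fromℤ-^ d 2 (trans (fromℤ≈ι d) ι-S))
             (-‿cong (fromℤ-^ e 2 (trans (fromℤ-homo-* (+ q) k) (*-cong (fromℤ-pos q) k≈))))) ⟩
      N′ ^ 4 * (S ^ 2 - (fromℕ q * N′) ^ 2)
        ≈⟨ solve 3 (λ n S q → let i = con (+ 1) in
             n :* (n :* (n :* (n :* i))) :* (S :* (S :* i) :- q :* n :* (q :* n :* i))
             := n :* n :* n :* n :* (S :* S :- q :* n :* (q :* n))) refl N′ S (fromℕ q) ⟩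
      N′ * N′ * N′ * N′ * (S * S - (fromℕ q * N′) * (fromℕ q * N′)) ∎
      where
      k d e : ℤ
      k = + suc n
      d = + s ℤ.- + r
      e = + q ℤ.* k
      2k+1 2k-1 : ℕ
      2k+1 = 2 ℕ.* suc n ℕ.+ 1
      2k-1 = 2 ℕ.* suc n ∸ 1
      N N′ X₁ X₃ : Carrier
      N = fromℕ n
      N′ = 1# + N
      X₁ = 1# + (N + N)
      X₃ = 1# + (1# + (1# + (N + N)))
      fromℤ-^ : ∀ i n {t} → fromℤ i ≈ t → fromℤ (i ℤ.^ n) ≈ t ^ n
      fromℤ-^ i zero    i≈t = refl
      fromℤ-^ i (suc n) i≈t = trans (fromℤ-homo-* i (i ℤ.^ n)) (*-cong i≈t (fromℤ-^ i n i≈t))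
      k≈ : fromℤ k ≈ N′
      k≈ = trans (fromℤ-pos (suc n)) (fromℕ-suc n)
      2k-1≡ : 2k-1 ≡ suc (n ℕ.+ n)
      2k-1≡ = ≡.trans (ℕₚ.+-suc n (n ℕ.+ 0)) (≡.cong (λ m → suc (n ℕ.+ m)) (ℕₚ.+-identityʳ n))
      2k+1≡ : 2k+1 ≡ suc (suc (suc (n ℕ.+ n)))
      2k+1≡ = ≡.trans (ℕₚ.+-comm (2 ℕ.* suc n) 1) (≡.cong (λ m → suc (suc m)) 2k-1≡)
      X₁≈ : fromℕ 2k-1 ≈ X₁
      X₁≈ = trans (reflexive (≡.cong fromℕ 2k-1≡)) (trans (fromℕ-suc (n ℕ.+ n)) (+-congˡ (fromℕ-+ n n)))
      X₃≈ : fromℕ 2k+1 ≈ X₃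
      X₃≈ = trans (reflexive (≡.cong fromℕ 2k+1≡)) (trans (fromℕ-suc (suc (suc (n ℕ.+ n))))
        (+-congˡ (trans (fromℕ-suc (suc (n ℕ.+ n))) (+-congˡ (trans (fromℕ-suc (n ℕ.+ n)) (+-congˡ
            (fromℕ-+ n n)))))))
      denominator : fromℕ (4 ℕ.* (2k+1 ℕ.* 2k-1)) ≈ fromℕ 4 * (X₁ * X₃)
      denominator = trans (fromℕ-* 4 (2k+1 ℕ.* 2k-1)) (*-congˡ
        (trans (fromℕ-* 2k+1 2k-1) (trans (*-comm _ _) (*-cong X₁≈ X₃≈))))

    -- P² = 1/q² turns (s - r)² - (q ℓ)² into D² - ℓ², whereas `h-suc` has ℓ² - D². The resulting
    -- sign disappears later because h enters only through squares.
    h-step : ∀ n → h (suc n) ≈ - (P * P * F n) * h n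
    h-step n = invertible-cancelˡ u v uv≈1 (begin
      v * h (suc n)
        ≈⟨ h-suc n ⟩
      N′ * N′ * N′ * N′ * ((α + α + N) * (β + β + N)) * h n
        ≈⟨ *-congʳ (*-congˡ (*-cong (+-congʳ α+α≈1+D) (+-congʳ β+β≈1-D))) ⟩
      N′ * N′ * N′ * N′ * ((1# + D + N) * (1# - D + N)) * h n
        -- The factors `1#` are inserted in order to be replaced by `P * fromℕ q`, after which P²
        -- can be taken out.
        ≈⟨ solve 4 (λ n S P h → let k = con (+ 1) :+ n; D = S :* P in
              k :* k :* k :* k :* ((con (+ 1) :+ D :+ n) :* (con (+ 1) :- D :+ n)) :* h
              := (:- (k :* k :* k :* k :* (P :* P :* (S :* S) :- (con (+ 1) :* k) :* (con
                  (+ 1) :* k)))) :* h)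
             refl N S P (h n) ⟩
      - (N′ * N′ * N′ * N′ * (P * P * (S * S) - (1# * N′) * (1# * N′))) * h n
        ≈⟨ *-congʳ (-‿cong (*-congˡ (+-congˡ (-‿cong (*-cong (*-congʳ Pq≈1) (*-congʳ Pq≈1)))))) ⟨
      - (N′ * N′ * N′ * N′ * (P * P * (S * S) - (P * fromℕ q * N′) * (P * fromℕ q * N′))) * h n
        ≈⟨ solve 5 (λ k S P h q →
              (:- (k :* k :* k :* k :* (P :* P :* (S :* S) :- (P :* q :* k) :* (P :* q :* k)))) :* h
              := (:- (P :* P :* (k :* k :* k :* k :* (S :* S :- (q :* k) :* (q :* k))))) :* h)
             refl N′ S P (h n) (fromℕ q) ⟩
      - (P * P * (N′ * N′ * N′ * N′ * (S * S - (fromℕ q * N′) * (fromℕ q * N′)))) * h n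
        ≈⟨ *-congʳ (-‿cong (*-congˡ (F-value n))) ⟨
      - (P * P * (F n * v)) * h n
        ≈⟨ solve 4 (λ P F v h → (:- (P :* P :* (F :* v))) :* h := v :* ((:-
            (P :* P :* F)) :* h)) refl P (F n) v (h n) ⟩
      v * (- (P * P * F n) * h n) ∎)
      where
      N N′ X₁ X₃ u v : Carrier
      N = fromℕ n
      N′ = 1# + N
      X₁ = 1# + (N + N)
      X₃ = 1# + (1# + (1# + (N + N)))
      v = fromℕ 4 * (X₁ * X₃)
      -- As `1/suc k` is 1/(k + 1), these are the inverses of 4, 2n + 1 and 2n + 3.
      u = 1/suc 3 * (1/suc (n ℕ.+ n) * 1/suc (suc (suc (n ℕ.+ n))))
      X₃≈ : 1# + fromℕ (suc (suc (n ℕ.+ n))) ≈ X₃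
      X₃≈ = +-congˡ (trans (fromℕ-suc (suc (n ℕ.+ n))) (+-congˡ (trans (fromℕ-suc (n ℕ.+ n))
          (+-congˡ (fromℕ-+ n n)))))
      uv≈1 : u * v ≈ 1#
      uv≈1 = begin
        u * v
          ≈⟨ solve 6 (λ a b c d e f → a :* (b :* c) :* (d :* (e :* f)) := (a :* d) :* ((b :* e) :*
              (c :* f))) refl
               (1/suc 3) (1/suc (n ℕ.+ n)) (1/suc (suc (suc (n ℕ.+ n)))) (fromℕ 4) X₁ X₃ ⟩
        1/suc 3 * fromℕ 4 * (1/suc (n ℕ.+ n) * X₁ * (1/suc (suc (suc (n ℕ.+ n))) * X₃))
          ≈⟨ *-cong (1/-inverse 4) (*-cong (trans (*-congˡ (+-congˡ (sym (fromℕ-+ n n))))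
              (1/suc-inverse (n ℕ.+ n)))
                                           (trans (*-congˡ (sym X₃≈)) (1/suc-inverse (suc (suc
                                               (n ℕ.+ n)))))) ⟩
        1# * (1# * 1#)
          ≈⟨ trans (*-identityˡ _) (*-identityˡ _) ⟩
        1# ∎

    ι-E : ∀ m .{{_ : NonZero (q ℕ.^ (m ℕ.+ 1))}} → ι ((+ s ℤ.- + r) ℚ./ (q ℕ.^ (m ℕ.+ 1))) ≈ D * P ^ m
    ι-E m = begin
      E
        ≈⟨ *-identityʳ E ⟨
      E * 1#
        ≈⟨ *-congˡ (trans (sym (1^n≈1 (suc m))) (^-congˡ (suc m) (sym Pq≈1))) ⟩
      E * (P * fromℕ q) ^ suc m
        ≈⟨ *-congˡ (trans (^-distrib-* P (fromℕ q) (suc m)) (*-congˡ (sym (fromℕ-^ q (suc m))))) ⟩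
      E * (P ^ suc m * fromℕ (q ℕ.^ suc m))
        ≈⟨ *-congˡ (*-congˡ (reflexive (≡.cong (λ n → fromℕ (q ℕ.^ n)) (ℕₚ.+-comm 1 m)))) ⟩
      E * (P ^ suc m * fromℕ (q ℕ.^ (m ℕ.+ 1)))
        ≈⟨ solve 3 (λ E p Q → E :* (p :* Q) := (E :* Q) :* p) refl _ _ _ ⟩
      E * fromℕ (q ℕ.^ (m ℕ.+ 1)) * P ^ suc m
        ≈⟨ *-congʳ (trans (ι-/-* (+ s ℤ.- + r) (q ℕ.^ (m ℕ.+ 1))) ι-S) ⟩
      S * (P * P ^ m)
        ≈⟨ *-assoc S P (P ^ m) ⟨
      D * P ^ m ∎
      where E = ι ((+ s ℤ.- + r) ℚ./ (q ℕ.^ (m ℕ.+ 1)))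

    closed-form : ∀ m .{{_ : NonZero (q ℕ.^ (m ℕ.+ 1))}} → H (2 ℕ.* m ℕ.+ 1) b ≈
      ι ((ℚ.- 1ℚ) ^ℚ (m ℕ.+ 1)
         ℚ.* ((+ s ℤ.- + r) ℚ./ (q ℕ.^ (m ℕ.+ 1))) ^ℚ (2 ℕ.* m ℕ.+ 2)
         ℚ.* ∏₁ m (λ l → factor q r s l ^ℚ (2 ℕ.* (m ℕ.+ 1 ∸ l))))
    closed-form m = begin
      H (2 ℕ.* m ℕ.+ 1) b
        ≈⟨ H-odd m ⟩
      blockProduct (suc m) h
        ≈⟨ blockProduct-closed P m h F h-step ⟩
      (- 1#) ^ suc m * (h 0 * P ^ m * (h 0 * P ^ m)) ^ suc m * weightedProduct m F
        ≈⟨ *-cong (*-cong signs (trans (^-congˡ (suc m) squares) powers)) (sym (ι-∏₁ m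
            (λ l → factor q r s l))) ⟩
      ι ((ℚ.- 1ℚ) ^ℚ (m ℕ.+ 1)) * ι (E ^ℚ (2 ℕ.* m ℕ.+ 2)) * ι (∏₁ m (λ l → factor q r s l ^ℚ
          (2 ℕ.* (m ℕ.+ 1 ∸ l))))
        ≈⟨ trans (ι.*-homo _ _) (*-congʳ (ι.*-homo _ _)) ⟨
      ι ((ℚ.- 1ℚ) ^ℚ (m ℕ.+ 1) ℚ.* E ^ℚ (2 ℕ.* m ℕ.+ 2) ℚ.* ∏₁ m (λ l → factor q r s l ^ℚ (2 ℕ.*
          (m ℕ.+ 1 ∸ l)))) ∎
      where
      E = (+ s ℤ.- + r) ℚ./ (q ℕ.^ (m ℕ.+ 1))
      signs : (- 1#) ^ suc m ≈ ι ((ℚ.- 1ℚ) ^ℚ (m ℕ.+ 1))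
      signs = trans (^-congʳ (- 1#) (ℕₚ.+-comm 1 m))
        (trans (^-congˡ (m ℕ.+ 1) (sym (trans (ι.-‿homo 1ℚ) (-‿cong ι.1#-homo)))) (sym (ι-^
            (ℚ.- 1ℚ) (m ℕ.+ 1))))
      squares : h 0 * P ^ m * (h 0 * P ^ m) ≈ ι E * ι E
      squares = begin
        h 0 * P ^ m * (h 0 * P ^ m)
          ≈⟨ *-cong (*-congʳ h₀) (*-congʳ h₀) ⟩
        (β - α) * P ^ m * ((β - α) * P ^ m)
          -- `h 0` is -D, and the sign is lost in the square.
          ≈⟨ solve 3 (λ α β p → (β :- α) :* p :* ((β :- α) :* p) := (α :- β) :* p :*
              ((α :- β) :* p)) refl α β _ ⟩
        (α - β) * P ^ m * ((α - β) * P ^ m)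
          ≈⟨ *-cong (trans (*-congʳ α-β≈D) (sym (ι-E m))) (trans (*-congʳ α-β≈D) (sym (ι-E m))) ⟩
        ι E * ι E ∎
      powers : (ι E * ι E) ^ suc m ≈ ι (E ^ℚ (2 ℕ.* m ℕ.+ 2))
      powers = trans (sym (x^2n≈[x*x]^n (ι E) (suc m)))
        (trans (^-congʳ (ι E) (≡.trans (ℕₚ.*-suc 2 m) (ℕₚ.+-comm 2 (2 ℕ.* m)))) (sym (ι-^ E
            (2 ℕ.* m ℕ.+ 2))))

theorem3p3 :
  ∀ {c ℓ} (A : CommutativeℚAlgebra c ℓ) →
  let open CommutativeℚAlgebra A
      open ℚAlgebraDefs A
  in
  (q r s : ℕ) .{{_ : NonZero q}} → r < s → (x : Carrier) (m : ℕ) →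
  let b = bernoulliDifference q r s x
      instance _ = m^n≢0 q (m ℕ.+ 1)
  in
    (H (2 ℕ.* m) b ≈ 0#)
  × (H (2 ℕ.* m ℕ.+ 1) b ≈
      ι ((ℚ.- 1ℚ) ^ℚ (m ℕ.+ 1)
         ℚ.* ((+ s ℤ.- + r) ℚ./ (q ℕ.^ (m ℕ.+ 1))) ^ℚ (2 ℕ.* m ℕ.+ 2)
         ℚ.* ∏₁ m (λ l → factor q r s l ^ℚ (2 ℕ.* (m ℕ.+ 1 ∸ l)))))
theorem3p3 A q r s _ x m = H-even m , closed-form m {{m^n≢0 q (m ℕ.+ 1)}}
  where open Proof.Main A q r s x
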